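{- Let $\alpha$ be a snowy weak composition, and take positive integers $m,n$ with $\mathsf{supp}(\alpha)\subseteq[n]$ and $m\ge\max(\alpha)$. Let $w=\mathsf{std}_{m,n}(\alpha)$. Then $r_{m,n}(\widehat{\mathfrak{L}}_\alpha)=\mathfrak{S}_w$.
   Context: A weak composition is an infinite sequence $\alpha=(\alpha_1,\alpha_2,\dots)$ of non-negative integers with finitely many positive entries; $\mathsf{supp}(\alpha)=\{i:\alpha_i>0\}$; $x^\alpha=\prod_i x_i^{\alpha_i}$; $\alpha$ is a partition if it is weakly decreasing; $\alpha$ is snowy if its positive entries are pairwise distinct; $s_i\alpha$ swaps entries $i$ and $i+1$. For $\alpha$ with $\mathsf{supp}(\alpha)\subseteq[n]$ and all $\alpha_i\le m$, set $r_{m,n}(\alpha)=(m-\alpha_n,\dots,m-\alpha_1)$. For a polynomial $f\in\mathbb{Q}[x_1,\dots,x_n]$ with each variable of exponent at most $m$, $r_{m,n}(f)=x_1^m\cdots x_n^m f(x_n^{ -1},\dots,x_1^{ -1})$. Operators: $\partial_i(f)=\frac{f-s_if}{x_i-x_{i+1}}$ (where $s_i$ swaps $x_i,x_{i+1}$), $\widehat{\pi}_i(f)=x_ix_{i+1}\partial_i(f)$. Top Lascoux polynomials for snowy $\alpha$: $\widehat{\mathfrak{L}}_\alpha=x^\alpha$ if $\alpha$ is a partition, and $\widehat{\mathfrak{L}}_\alpha=\widehat{\pi}_i(\widehat{\mathfrak{L}}_{s_i\alpha})$ if $\alpha_i<\alpha_{i+1}$ (this is well defined). Schubert polynomials: for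 $w$ a permutation of $\{1,2,\dots\}$ fixing all but finitely many elements, $\mathsf{invcode}(w)_i=|\{j>i:w(j)<w(i)\}|$; $w$ is dominant if $\mathsf{invcode}(w)$ is a partition; $\mathfrak{S}_w=x^{\mathsf{invcode}(w)}$ if $w$ is dominant, and $\mathfrak{S}_w=\partial_i(\mathfrak{S}_{ws_i})$ if $w(i)<w(i+1)$. Standardization: for snowy $\alpha$ with $\mathsf{supp}(\alpha)\subseteq[n]$ and $m\ge\max(\alpha)$, let $\beta=r_{m+1,n}(\alpha)$; $\mathsf{std}_{m,n}(\alpha)$ is the unique permutation $w$ with $w(n+1)<w(n+2)<\cdots$ and, for $i\in[n]$, $w(i)=\beta_i$ if $\beta_i\le m$, and $w(i)=m+|\{j\in[i]:\beta_j=m+1\}|$ if $\beta_i=m+1$. -}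

module Defs where

open import Data.Nat using (ℕ; zero; suc; _+_; _*_; _∸_; _≤_; _<_; _<ᵇ_; _≤ᵇ_; _≡ᵇ_)
open import Data.Integer using (ℤ) renaming (_+_ to _+ℤ_; -_ to -ℤ_; 0ℤ to zeroℤ; 1ℤ to oneℤ)
open import Data.Bool using (Bool; true; false; if_then_else_; _∧_; not)
open import Data.List using (List; []; _∷_; _++_; map; filter; length; reverse; upTo; concatMap; foldr)
open import Data.Maybe using (Maybe; just; nothing)
open import Data.Product using (_×_; _,_)
open import Data.Vec using (Vec; lookup; toList)
open import Data.Fin using (Fin)
open import Relation.Binary.PropositionalEquality using (_≡_; _≢_)

-- Weak compositions / exponent vectors are finite lists of naturals,
-- implicitly extended by zeros.  Positions are 0-based internally:
-- list index i corresponds to the variable x_{i+1} / entry α_{i+1}.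

get : List ℕ → ℕ → ℕ
get []       _       = 0
get (x ∷ xs) zero    = x
get (x ∷ xs) (suc i) = get xs i

set : List ℕ → ℕ → ℕ → List ℕ
set []       zero    v = v ∷ []
set []       (suc i) v = 0 ∷ set [] i v
set (x ∷ xs) zero    v = v ∷ xs
set (x ∷ xs) (suc i) v = x ∷ set xs i v

swapAt : ℕ → List ℕ → List ℕ
swapAt i a = set (set a i (get a (suc i))) (suc i) (get a i)

strip : List ℕ → List ℕ
strip [] = []
strip (x ∷ xs) with strip xs
... | [] = if x ≡ᵇ 0 then [] else x ∷ []
... | y ∷ ys = x ∷ y ∷ ys

eqL : List ℕ → List ℕ → Bool
eqL [] [] = true
eqL (x ∷ xs) (y ∷ ys) = (x ≡ᵇ y) ∧ eqL xs ys
eqL _ _ = false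

isPartition : List ℕ → Bool
isPartition [] = true
isPartition (x ∷ []) = true
isPartition (x ∷ y ∷ xs) = (y ≤ᵇ x) ∧ isPartition (y ∷ xs)

firstAscent : List ℕ → Maybe ℕ
firstAscent [] = nothing
firstAscent (x ∷ xs) = go x xs
  where
  go : ℕ → List ℕ → Maybe ℕ
  go x [] = nothing
  go x (y ∷ ys) = if x <ᵇ y then just 0 else Data.Maybe.map suc (go y ys)

-- Polynomials in x_1, x_2, ... with integer coefficients, as formal sums
-- of terms (coefficient, exponent vector).  Equality is coefficientwise.

Term : Set
Term = ℤ × List ℕ

Poly : Set
Poly = List Term

mono : List ℕ → Poly
mono a = (oneℤ , a) ∷ []

sumℤ : List ℤ → ℤ
sumℤ = foldr _+ℤ_ zeroℤ

coeff : Poly → List ℕ → ℤ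
coeff f μ = sumℤ (map (λ { (c , a) → if eqL (strip a) (strip μ) then c else zeroℤ }) f)

_≈P_ : Poly → Poly → Set
f ≈P g = ∀ μ → coeff f μ ≡ coeff g μ

-- Divided difference ∂_{i+1} (0-based index i), computed termwise:
-- (x_i^p x_{i+1}^q - x_i^q x_{i+1}^p)/(x_i - x_{i+1})
--   = ± Σ_{k<d} x_i^{lo+k} x_{i+1}^{lo+d-1-k},  lo = min(p,q), d = |p-q|,
-- with sign + if p > q and - if p < q (and 0 if p = q).

∂term : ℕ → Term → Poly
∂term i (c , a) with get a i | get a (suc i)
... | p | q =
  let lo = if p ≤ᵇ q then p else q
      d  = (p ∸ q) + (q ∸ p)
      c' = if q <ᵇ p then c else -ℤ c
  in map (λ k → c' , set (set a i (lo + k)) (suc i) (lo + (d ∸ 1 ∸ k))) (upTo d)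

∂ : ℕ → Poly → Poly
∂ i = concatMap (∂term i)

mulXX : ℕ → Term → Term
mulXX i (c , a) = c , set (set a i (suc (get a i))) (suc i) (suc (get a (suc i)))

π̂ : ℕ → Poly → Poly
π̂ i f = map (mulXX i) (∂ i f)

rExp : ℕ → ℕ → List ℕ → List ℕ
rExp m n a = map (λ j → m ∸ get a (n ∸ 1 ∸ j)) (upTo n)

rPoly : ℕ → ℕ → Poly → Poly
rPoly m n = map (λ { (c , a) → c , rExp m n a })

-- Top Lascoux polynomials (snowy α): x^α if α is a partition, otherwise
-- π̂_i L̂_{s_i α} for the first i with α_i < α_{i+1}.  Recursion is by
-- fuel; fuel (length α)² suffices (each step removes one pair i<j with
-- α_i < α_j).

hatLfuel : ℕ → List ℕ → Poly
hatLfuel zero a = []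
hatLfuel (suc f) a with isPartition a | firstAscent a
... | true  | _       = mono a
... | false | just i  = π̂ i (hatLfuel f (swapAt i a))
... | false | nothing = []

hatL : List ℕ → Poly
hatL a = hatLfuel (length a * length a) a

-- Schubert polynomials.  A permutation w of {1,2,...} fixing every
-- j > N is represented by its one-line notation (w(1), ..., w(N)).

countLess : ℕ → List ℕ → ℕ
countLess x xs = length (filter (λ y → y Data.Nat.<? x) xs)

invcode : List ℕ → List ℕ
invcode [] = []
invcode (x ∷ xs) = countLess x xs ∷ invcode xs

-- S_w = x^{invcode w} if w dominant, else ∂_i S_{w s_i} for the first i
-- with w(i) < w(i+1).  Fuel (length w)² suffices.
schubFuel : ℕ → List ℕ → Poly
schubFuel zero w = []
schubFuel (suc f) w with isPartition (invcode w) | firstAscent w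
... | true  | _       = mono (invcode w)
... | false | just i  = ∂ i (schubFuel f (swapAt i w))
... | false | nothing = []

schubert : List ℕ → Poly
schubert w = schubFuel (length w * length w) w

-- Standardization std_{m,n}(α), returned as the one-line notation of w
-- on [n + m] (w fixes every j > n + m, since w([n]) ⊆ [n + m] and
-- w(n+1) < w(n+2) < ...).

memb : ℕ → List ℕ → Bool
memb x [] = false
memb x (y ∷ ys) = (x ≡ᵇ y) Data.Bool.∨ memb x ys

stdHead : ℕ → ℕ → List ℕ → List ℕ
stdHead m c [] = []
stdHead m c (b ∷ bs) =
  if b ≤ᵇ m then b ∷ stdHead m c bs
            else (m + suc c) ∷ stdHead m (suc c) bs

std : (m n : ℕ) → Vec ℕ n → List ℕ
std m n α =
  let β  = rExp (suc m) n (toList α)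
      hd = stdHead m 0 β
      tl = filter (λ v → Data.Bool.T? (not (memb v hd))) (map suc (upTo (n + m)))
  in hd ++ tl

Snowy : ∀ {n} → Vec ℕ n → Set
Snowy {n} α = (i j : Fin n) → i ≢ j → 0 < lookup α i → lookup α i ≢ lookup α j

{-# OPTIONS --safe #-}

-- The reflection r_{m,n} turns π̂_i into ∂_{n−i}, and standardization turns s_i
-- into s_{n−i}, so the recursion for top Lascoux polynomials is carried to the
-- recursion for Schubert polynomials. For a snowy partition α the permutation
-- std_{m,n}(α) is dominant with code r_{m,n}(α), which settles the base case.
-- An ascent of α is mirrored to an ascent of w that need not be the first one, so
-- 𝔖_w = ∂_j 𝔖_{w s_j} is needed at every ascent j. By induction on the number of
-- noninversions and the commutation and braid relations for ∂, it reduces to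
-- the first ascent; there, if w is dominant, w s_j is dominant as well and its code
-- is that of w raised by one in position j. The relations for ∂ hold because
-- ∂_i f is the unique solution G of (x_i − x_{i+1}) G = f − s_i f.
module Submission where

open import Defs
open import Data.Bool using (Bool; true; false; if_then_else_; _∧_; T; T?; not)
open import Data.Bool.Properties using (⇔→≡; ∧-zeroʳ; ∧-comm; T-≡; T-∧; T-∨)
import Data.Fin.Properties as Fin
open import Data.Fin using (zero; suc)
open import Data.Integer using (ℤ) renaming (-_ to -ℤ_)
open import Data.List using (List; []; _∷_; _++_; map; length; filter; reverse; replicate; upTo; applyUpTo; applyDownFrom)
open import Data.List.Membership.Propositional using (_∈_)
open import Data.List.Membership.Propositional.Properties
  using (∈-filter⁺; ∈-filter⁻; ∈-map⁺; ∈-map⁻; ∈-upTo⁺; ∈-upTo⁻; ∈-++⁺ˡ; ∈-++⁺ʳ)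
open import Data.List.Membership.Propositional.Properties.WithK using (unique∧set⇒bag)
open import Data.List.Properties
  using (map-++; map-∘; map-cong; map-upTo; map-applyUpTo; reverse-applyUpTo; reverse-map; reverse-++;
         unfold-reverse; ++-assoc; length-map; length-reverse; length-++; length-upTo;
         filter-≐; filter-none; filter-accept; filter-reject; length-filter)
open import Data.List.Relation.Binary.BagAndSetEquality using (∼bag⇒↭)
open import Data.List.Relation.Binary.Permutation.Propositional using (_↭_; prep; swap; ↭-refl; ↭-sym)
open import Data.List.Relation.Binary.Permutation.Propositional.Properties
  using (filter-↭; ↭-length; All-resp-↭; ∈-resp-↭; ↭-reverse)
open import Data.List.Relation.Binary.Pointwise as Pointwise using (Pointwise; []; _∷_)
open import Data.List.Relation.Unary.All as All using (All; []; _∷_)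
import Data.List.Relation.Unary.All.Properties as All
open import Data.List.Relation.Unary.AllPairs as AllPairs using (AllPairs; []; _∷_)
import Data.List.Relation.Unary.AllPairs.Properties as AllPairs
open import Data.List.Relation.Unary.Any using (here; there)
open import Data.List.Relation.Unary.Unique.Propositional using (Unique)
import Data.List.Relation.Unary.Unique.Propositional.Properties as Unique
open import Data.Maybe as Maybe using (Maybe; just; nothing)
open import Data.Nat as ℕ
  using (ℕ; zero; suc; pred; _∸_; _≡ᵇ_; _≤ᵇ_; _<ᵇ_; _<_; _≤_; s≤s; z≤n; s<s; z<s; s<s⁻¹; s≤s⁻¹; _<?_; _≤?_)
import Data.Nat.Properties as ℕ
open import Data.Product using (_×_; _,_; proj₁; proj₂; ∃; ∃₂)
open import Data.Sum as Sum using (_⊎_; inj₁; inj₂)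
open import Data.Vec using (Vec; []; _∷_; lookup; toList)
open import Data.Vec.Properties using (length-toList)
open import Function using (_∘_; id; flip; _⇔_; mk⇔; Equivalence)
open import Level using (0ℓ)
open import Relation.Binary using (Rel; Setoid; Symmetric)
open import Relation.Binary.PropositionalEquality
import Relation.Binary.Reasoning.Setoid as SetoidReasoning
open import Relation.Nullary using (¬_; Dec; yes; no; contradiction)
open import Relation.Nullary.Decidable using (dec-true; dec-false)

-- Polynomials are unreduced sums compared by coefficients, so even the fact that `∂` respects
-- equality cannot be read off term by term: equal polynomials may differ by cancelling terms. The
-- remedy is to forget the terms. With all other exponents frozen, the coefficients of f form an
-- array in the exponents of x_i and x_{i+1}. Multiplication by x_i - x_{i+1} is injective on all
-- such arrays, so congruence, commutation and the braid relation all follow by clearing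
-- denominators.
--
-- The Schubert recursion stops at every dominant permutation, even one that still has ascents; at
-- such a `w` even the equation at the first ascent is not part of the definition. The fuel is
-- harmless because each step removes exactly one noninversion.
--
-- The factor x_i x_{i+1} in π̂_i makes the reflection work: ∂_i lowers the degree by one, and
-- without the factor both reflected exponents would be too large by one. The shift from m to m + 1
-- in the standardization turns exponents into values: for a partition α, an entry b ≤ m has exactly
-- the values 1, ..., b - 1 below it to its right, so its code is b - 1.

module DividedDifferences where

  open import Data.Integer using (0ℤ; _+_; _-_; -_)
  open import Data.Integer.Properties using (+-inverseʳ; +-identityˡ; +-assoc)
  open import Data.Integer.Tactic.RingSolver using (solve-∀)

  -- Arrays of coefficients and division by x - y

  interchange : ∀ p q r s → (p - q) - (r - s) ≡ (p - r) - (q - s)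
  interchange = solve-∀

  -- Arrays ℕ → … → ℤ stand for (formal) power series by their coefficients, and
  -- shift for the multiplication by a variable; mulDiff G is thus (x − y) G.
  shift : (ℕ → ℤ) → ℕ → ℤ
  shift g zero    = 0ℤ
  shift g (suc k) = g k

  shift-cong : ∀ {f g : ℕ → ℤ} → (∀ k → f k ≡ g k) → ∀ k → shift f k ≡ shift g k
  shift-cong e zero    = refl
  shift-cong e (suc k) = e k

  shift-sub : ∀ (f g : ℕ → ℤ) k → shift (λ j → f j - g j) k ≡ shift f k - shift g k
  shift-sub f g zero    = refl
  shift-sub f g (suc k) = refl

  shift-add : ∀ (f g : ℕ → ℤ) k → shift (λ j → f j + g j) k ≡ shift f k + shift g k
  shift-add f g zero    = refl
  shift-add f g (suc k) = refl

  shift-comm : ∀ (f : ℕ → ℕ → ℤ) a b →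
    shift (λ x → shift (f x) b) a ≡ shift (λ y → shift (λ x → f x y) a) b
  shift-comm f zero    zero    = refl
  shift-comm f zero    (suc b) = refl
  shift-comm f (suc a) zero    = refl
  shift-comm f (suc a) (suc b) = refl

  mulDiff : (ℕ → ℕ → ℤ) → ℕ → ℕ → ℤ
  mulDiff G x y = shift (λ u → G u y) x - shift (G x) y

  mulDiff-cong : ∀ {G H : ℕ → ℕ → ℤ} → (∀ x y → G x y ≡ H x y) → ∀ x y → mulDiff G x y ≡ mulDiff H x y
  mulDiff-cong e x y = cong₂ _-_ (shift-cong (λ u → e u y) x) (shift-cong (e x) y)

  mulDiff-sub : ∀ (G H : ℕ → ℕ → ℤ) x y →
    mulDiff (λ u v → G u v - H u v) x y ≡ mulDiff G x y - mulDiff H x y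
  mulDiff-sub G H x y
    rewrite shift-sub (λ u → G u y) (λ u → H u y) x | shift-sub (G x) (H x) y =
    interchange (shift (λ u → G u y) x) (shift (λ u → H u y) x) (shift (G x) y) (shift (H x) y)

  -- The coefficient of (x - y) G at (0, y + 1) is -G(0, y), and at (x + 1, y + 1) it is G(x, y + 1)
  -- - G(x + 1, y). So G is recovered row by row, by induction on x.
  mulDiff-cancel : ∀ {G H : ℕ → ℕ → ℤ} → (∀ x y → mulDiff G x y ≡ mulDiff H x y) →
    ∀ x y → G x y ≡ H x y
  mulDiff-cancel {G} {H} e zero y = trans (lem (G 0 y)) (trans (cong -_ (e 0 (suc y))) (sym (lem (H 0 y))))
    where
    lem : ∀ p → p ≡ - (0ℤ - p)
    lem = solve-∀
  mulDiff-cancel {G} {H} e (suc x) y =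
    trans (lem (G x (suc y)) (G (suc x) y))
      (trans (cong₂ _-_ (mulDiff-cancel e x (suc y)) (e (suc x) (suc y)))
        (sym (lem (H x (suc y)) (H (suc x) y))))
    where
    lem : ∀ p q → q ≡ p - (p - q)
    lem = solve-∀

  -- G = (F − F′) / (x − y), where F′ is F with x and y exchanged.
  record Quotient (F G : ℕ → ℕ → ℤ) : Set where
    constructor quotient
    field mulDiff-quotient : ∀ x y → mulDiff G x y ≡ F x y - F y x

  open Quotient public

  quotient-unique : ∀ {F F′ G G′} → (∀ x y → F x y ≡ F′ x y) → Quotient F G → Quotient F′ G′ →
    ∀ x y → G x y ≡ G′ x y
  quotient-unique e q q′ = mulDiff-cancel λ x y →
    trans (mulDiff-quotient q x y)
      (trans (cong₂ _-_ (e x y) (e y x)) (sym (mulDiff-quotient q′ x y)))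

  -- Both F - F′ and x - y change sign when x and y are exchanged, so G and its transpose have the
  -- same product with x - y.
  quotient-symmetric : ∀ {F G} → Quotient F G → ∀ x y → G x y ≡ G y x
  quotient-symmetric {F} {G} q = mulDiff-cancel λ x y →
    trans (mulDiff-quotient q x y) (trans (lem (F x y) (F y x))
      (trans (cong -_ (sym (mulDiff-quotient q y x)))
      (lem′ (shift (λ u → G u x) y) (shift (G y) x))))
    where
    lem : ∀ p q → p - q ≡ - (q - p)
    lem = solve-∀
    lem′ : ∀ p q → - (p - q) ≡ q - p
    lem′ = solve-∀

  mulDiff-comm₄ : ∀ (H : ℕ → ℕ → ℕ → ℕ → ℤ) a b c d →
    mulDiff (λ x y → mulDiff (H x y) c d) a b ≡ mulDiff (λ z w → mulDiff (λ x y → H x y z w) a b) c d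
  mulDiff-comm₄ H a b c d
    rewrite shift-sub (λ x → shift (λ z → H x b z d) c) (λ x → shift (λ w → H x b c w) d) a
          | shift-sub (λ y → shift (λ z → H a y z d) c) (λ y → shift (λ w → H a y c w) d) b
          | shift-sub (λ z → shift (λ x → H x b z d) a) (λ z → shift (λ y → H a y z d) b) c
          | shift-sub (λ w → shift (λ x → H x b c w) a) (λ w → shift (λ y → H a y c w) b) d
          | shift-comm (λ x z → H x b z d) a c
          | shift-comm (λ x w → H x b c w) a d
          | shift-comm (λ y z → H a y z d) b c
          | shift-comm (λ y w → H a y c w) b d
    = interchange (shift (λ z → shift (λ x → H x b z d) a) c) (shift (λ w → shift (λ x → H x b c w) a) d)
          (shift (λ z → shift (λ y → H a y z d) b) c) (shift (λ w → shift (λ y → H a y c w) b) d)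

  -- Multiplied by (x - y)(z - w), either iterated quotient becomes the signed sum of F over the
  -- four exchanges within {x, y} and {z, w}; the two factors are then cancelled in turn.
  quotient-comm : ∀ {F G H G′ H′ : ℕ → ℕ → ℕ → ℕ → ℤ} →
    (∀ z w → Quotient (λ x y → F x y z w) (λ x y → G x y z w)) →
    (∀ x y → Quotient (G x y) (H x y)) →
    (∀ x y → Quotient (F x y) (G′ x y)) →
    (∀ z w → Quotient (λ x y → G′ x y z w) (λ x y → H′ x y z w)) →
    ∀ x y z w → H x y z w ≡ H′ x y z w
  quotient-comm {F} {G} {H} {G′} {H′} qG qH qG′ qH′ x y z w =
    mulDiff-cancel (λ z w → mulDiff-cancel (λ x y → begin
      mulDiff (λ x y → mulDiff (H x y) z w) x y
        ≡⟨ mulDiff-cong (λ x y → mulDiff-quotient (qH x y) z w) x y ⟩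
      mulDiff (λ x y → G x y z w - G x y w z) x y
        ≡⟨ mulDiff-sub (λ x y → G x y z w) (λ x y → G x y w z) x y ⟩
      mulDiff (λ x y → G x y z w) x y - mulDiff (λ x y → G x y w z) x y
        ≡⟨ cong₂ _-_ (mulDiff-quotient (qG z w) x y) (mulDiff-quotient (qG w z) x y) ⟩
      (F x y z w - F y x z w) - (F x y w z - F y x w z)
        ≡⟨ interchange (F x y z w) (F y x z w) (F x y w z) (F y x w z) ⟩
      (F x y z w - F x y w z) - (F y x z w - F y x w z)
        ≡⟨ cong₂ _-_ (mulDiff-quotient (qG′ x y) z w) (mulDiff-quotient (qG′ y x) z w) ⟨
      mulDiff (G′ x y) z w - mulDiff (G′ y x) z w
        ≡⟨ mulDiff-sub (G′ x y) (G′ y x) z w ⟨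
      mulDiff (λ z w → G′ x y z w - G′ y x z w) z w
        ≡⟨ mulDiff-cong (λ z w → mulDiff-quotient (qH′ z w) x y) z w ⟨
      mulDiff (λ z w → mulDiff (λ x y → H′ x y z w) x y) z w
        ≡⟨ mulDiff-comm₄ H′ x y z w ⟨
      mulDiff (λ x y → mulDiff (H′ x y) z w) x y ∎) x y) z w
    where
    open ≡-Reasoning

  Fun₃ : Set
  Fun₃ = ℕ → ℕ → ℕ → ℤ

  mul₁₂ mul₁₃ mul₂₃ : Fun₃ → Fun₃
  mul₁₂ G a b c = mulDiff (λ x y → G x y c) a b
  mul₁₃ G a b c = mulDiff (λ x z → G x b z) a c
  mul₂₃ G a b c = mulDiff (G a) b c

  -- Linear factors that share a variable commute. The private names are the quadratic monomials of
  -- the expanded products, the mixed shifts being put in one order by `shift-comm`.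
  module _ (G : Fun₃) (a b c : ℕ) where
    private
      x² = shift (λ x → shift (λ w → G w b c) x) a
      y² = shift (λ y → shift (λ w → G a w c) y) b
      z² = shift (λ z → shift (λ w → G a b w) z) c
      xy = shift (λ y → shift (λ x → G x y c) a) b
      xz = shift (λ z → shift (λ x → G x b z) a) c
      yz = shift (λ z → shift (λ y → G a y z) b) c

    mul₁₃-mul₂₃ : mul₁₃ (mul₂₃ G) a b c ≡ mul₂₃ (mul₁₃ G) a b c
    mul₁₃-mul₂₃
      rewrite shift-sub (λ x → shift (λ y → G x y c) b) (λ x → shift (λ z → G x b z) c) a
            | shift-sub (λ z → shift (λ y → G a y z) b) (λ z → shift (λ w → G a b w) z) c
            | shift-sub (λ y → shift (λ x → G x y c) a) (λ y → shift (G a y) c) b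
            | shift-sub (λ z → shift (λ x → G x b z) a) (λ z → shift (λ w → G a b w) z) c
            | shift-comm (λ x y → G x y c) a b
            | shift-comm (λ x z → G x b z) a c
            | shift-comm (G a) b c = interchange xy xz yz z²

    mul₁₂-mul₁₃ : mul₁₂ (mul₁₃ G) a b c ≡ mul₁₃ (mul₁₂ G) a b c
    mul₁₂-mul₁₃
      rewrite shift-sub (λ x → shift (λ w → G w b c) x) (λ x → shift (λ z → G x b z) c) a
            | shift-sub (λ y → shift (λ x → G x y c) a) (λ y → shift (G a y) c) b
            | shift-sub (λ x → shift (λ w → G w b c) x) (λ x → shift (λ y → G x y c) b) a
            | shift-sub (λ z → shift (λ x → G x b z) a) (λ z → shift (λ y → G a y z) b) c
            | shift-comm (λ x y → G x y c) a b
            | shift-comm (λ x z → G x b z) a c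
            | shift-comm (G a) b c = interchange x² xz xy yz

    mul₁₂-mul₂₃ : mul₁₂ (mul₂₃ G) a b c ≡ mul₂₃ (mul₁₂ G) a b c
    mul₁₂-mul₂₃
      rewrite shift-sub (λ x → shift (λ y → G x y c) b) (λ x → shift (λ z → G x b z) c) a
            | shift-sub (λ y → shift (λ w → G a w c) y) (λ y → shift (G a y) c) b
            | shift-sub (λ y → shift (λ x → G x y c) a) (λ y → shift (λ w → G a w c) y) b
            | shift-sub (λ z → shift (λ x → G x b z) a) (λ z → shift (λ y → G a y z) b) c
            | shift-comm (λ x y → G x y c) a b
            | shift-comm (λ x z → G x b z) a c
            | shift-comm (G a) b c = interchange xy xz y² yz

  -- Multiplied by (x − y)(x − z)(y − z), either threefold quotient becomes the
  -- alternating sum of F over the permutations of x, y, z.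
  quotient-braid : ∀ {F g₁ g₂₁ g₁₂₁ h₂ h₁₂ h₂₁₂ : Fun₃} →
    (∀ z → Quotient (λ x y → F x y z) (λ x y → g₁ x y z)) →
    (∀ x → Quotient (g₁ x) (g₂₁ x)) →
    (∀ z → Quotient (λ x y → g₂₁ x y z) (λ x y → g₁₂₁ x y z)) →
    (∀ x → Quotient (F x) (h₂ x)) →
    (∀ z → Quotient (λ x y → h₂ x y z) (λ x y → h₁₂ x y z)) →
    (∀ x → Quotient (h₁₂ x) (h₂₁₂ x)) →
    ∀ x y z → g₁₂₁ x y z ≡ h₂₁₂ x y z
  quotient-braid {F} {g₁} {g₂₁} {g₁₂₁} {h₂} {h₁₂} {h₂₁₂} q₁ q₂₁ q₁₂₁ r₂ r₁₂ r₂₁₂ x y z =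
    mulDiff-cancel (λ x y → mulDiff-cancel (λ y z → mulDiff-cancel (λ x z →
      trans (left x y z) (sym (right x y z))) x z) y z) x y
    where
    open ≡-Reasoning

    alternating : Fun₃
    alternating a b c = F a b c - F b a c - F a c b + F c a b + F b c a - F c b a

    left₁ : ∀ a b c → mul₁₃ (mul₂₃ g₂₁) a b c ≡ mul₁₃ g₁ a b c - (F a c b - F c a b)
    left₁ a b c = begin
      mul₁₃ (mul₂₃ g₂₁) a b c
        ≡⟨ mulDiff-cong (λ u w → mulDiff-quotient (q₂₁ u) b w) a c ⟩
      mulDiff (λ u w → g₁ u b w - g₁ u w b) a c
        ≡⟨ mulDiff-sub (λ u w → g₁ u b w) (λ u w → g₁ u w b) a c ⟩
      mul₁₃ g₁ a b c - mul₁₂ g₁ a c b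
        ≡⟨ cong (λ t → mul₁₃ g₁ a b c - t) (mulDiff-quotient (q₁ b) a c) ⟩
      mul₁₃ g₁ a b c - (F a c b - F c a b) ∎

    left : ∀ a b c → mul₁₃ (mul₂₃ (mul₁₂ g₁₂₁)) a b c ≡ alternating a b c
    left a b c = begin
      mul₁₃ (mul₂₃ (mul₁₂ g₁₂₁)) a b c
        ≡⟨ mulDiff-cong (λ u w → trans (mulDiff-cong (λ v w → mulDiff-quotient (q₁₂₁ w) u v) b w)
             (mulDiff-sub (g₂₁ u) (λ v w → g₂₁ v u w) b w)) a c ⟩
      mulDiff (λ u w → mul₂₃ g₂₁ u b w - mul₁₃ g₂₁ b u w) a c
        ≡⟨ mulDiff-sub (λ u w → mul₂₃ g₂₁ u b w) (λ u w → mul₁₃ g₂₁ b u w) a c ⟩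
      mul₁₃ (mul₂₃ g₂₁) a b c - mul₂₃ (mul₁₃ g₂₁) b a c
        ≡⟨ cong (λ t → mul₁₃ (mul₂₃ g₂₁) a b c - t) (mul₁₃-mul₂₃ g₂₁ b a c) ⟨
      mul₁₃ (mul₂₃ g₂₁) a b c - mul₁₃ (mul₂₃ g₂₁) b a c
        ≡⟨ cong₂ _-_ (left₁ a b c) (left₁ b a c) ⟩
      (mul₁₃ g₁ a b c - (F a c b - F c a b)) - (mul₁₃ g₁ b a c - (F b c a - F c b a))
        -- As a quotient, `g₁` is symmetric in its first two arguments. After this exchange the
        -- multiples by z cancel and what remains of `g₁` is its product with x - y, which is known.
        ≡⟨ cong (λ t → (mul₁₃ g₁ a b c - (F a c b - F c a b)) - (t - (F b c a - F c b a)))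
             (mulDiff-cong (λ u w → quotient-symmetric (q₁ w) u a) b c) ⟩
      (mul₁₃ g₁ a b c - (F a c b - F c a b)) - (mul₂₃ g₁ a b c - (F b c a - F c b a))
        ≡⟨ lem (shift (λ u → g₁ u b c) a) (shift (g₁ a b) c) (shift (λ u → g₁ a u c) b)
             (F a c b) (F c a b) (F b c a) (F c b a) ⟩
      (mul₁₂ g₁ a b c - F a c b) + F c a b + F b c a - F c b a
        ≡⟨ cong (λ t → (t - F a c b) + F c a b + F b c a - F c b a) (mulDiff-quotient (q₁ c) a b) ⟩
      alternating a b c ∎
      where
      lem : ∀ p q r s t u v →
        ((p - q) - (s - t)) - ((r - q) - (u - v)) ≡ ((p - r) - s) + t + u - v
      lem = solve-∀

    right₁ : ∀ a b c → mul₁₃ (mul₁₂ h₁₂) a b c ≡ mul₁₃ h₂ a b c - (F b a c - F b c a)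
    right₁ a b c = begin
      mul₁₃ (mul₁₂ h₁₂) a b c
        ≡⟨ mulDiff-cong (λ u w → mulDiff-quotient (r₁₂ w) u b) a c ⟩
      mulDiff (λ u w → h₂ u b w - h₂ b u w) a c
        ≡⟨ mulDiff-sub (λ u w → h₂ u b w) (λ u w → h₂ b u w) a c ⟩
      mul₁₃ h₂ a b c - mul₂₃ h₂ b a c
        ≡⟨ cong (λ t → mul₁₃ h₂ a b c - t) (mulDiff-quotient (r₂ b) a c) ⟩
      mul₁₃ h₂ a b c - (F b a c - F b c a) ∎

    right : ∀ a b c → mul₁₃ (mul₂₃ (mul₁₂ h₂₁₂)) a b c ≡ alternating a b c
    right a b c = begin
      mul₁₃ (mul₂₃ (mul₁₂ h₂₁₂)) a b c
        -- `h₂₁₂` is a quotient in the last two variables, so the factor y - z has to act on it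
        -- first.
        ≡⟨ mulDiff-cong (λ u w → mul₁₂-mul₂₃ h₂₁₂ u b w) a c ⟨
      mul₁₃ (mul₁₂ (mul₂₃ h₂₁₂)) a b c
        ≡⟨ mulDiff-cong (λ u w → trans (mulDiff-cong (λ u v → mulDiff-quotient (r₂₁₂ u) v w) u b)
             (mulDiff-sub (λ u v → h₁₂ u v w) (λ u v → h₁₂ u w v) u b)) a c ⟩
      mulDiff (λ u w → mul₁₂ h₁₂ u b w - mul₁₃ h₁₂ u w b) a c
        ≡⟨ mulDiff-sub (λ u w → mul₁₂ h₁₂ u b w) (λ u w → mul₁₃ h₁₂ u w b) a c ⟩
      mul₁₃ (mul₁₂ h₁₂) a b c - mul₁₂ (mul₁₃ h₁₂) a c b
        ≡⟨ cong (λ t → mul₁₃ (mul₁₂ h₁₂) a b c - t) (mul₁₂-mul₁₃ h₁₂ a c b) ⟩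
      mul₁₃ (mul₁₂ h₁₂) a b c - mul₁₃ (mul₁₂ h₁₂) a c b
        ≡⟨ cong₂ _-_ (right₁ a b c) (right₁ a c b) ⟩
      (mul₁₃ h₂ a b c - (F b a c - F b c a)) - (mul₁₃ h₂ a c b - (F c a b - F c b a))
        ≡⟨ cong (λ t → (mul₁₃ h₂ a b c - (F b a c - F b c a)) - (t - (F c a b - F c b a)))
             (mulDiff-cong (λ u w → quotient-symmetric (r₂ u) c w) a b) ⟩
      (mul₁₃ h₂ a b c - (F b a c - F b c a)) - (mul₁₂ h₂ a b c - (F c a b - F c b a))
        ≡⟨ lem (shift (λ u → h₂ u b c) a) (shift (h₂ a b) c) (shift (λ u → h₂ a u c) b)
             (F b a c) (F b c a) (F c a b) (F c b a) ⟩
      mul₂₃ h₂ a b c - F b a c + F b c a + F c a b - F c b a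
        ≡⟨ cong (λ t → t - F b a c + F b c a + F c a b - F c b a) (mulDiff-quotient (r₂ a) b c) ⟩
      F a b c - F a c b - F b a c + F b c a + F c a b - F c b a
        ≡⟨ lem′ (F a b c) (F a c b) (F b a c) (F b c a) (F c a b) (F c b a) ⟩
      alternating a b c ∎
      where
      lem : ∀ p q r s t u v →
        ((p - q) - (s - t)) - ((p - r) - (u - v)) ≡ (r - q) - s + t + u - v
      lem = solve-∀
      lem′ : ∀ p q r s t u → p - q - r + s + t - u ≡ p - r - q + t + s - u
      lem′ = solve-∀

  -- Exponent vectors

  infix 4 _≐_
  _≐_ : List ℕ → List ℕ → Set
  a ≐ b = ∀ k → get a k ≡ get b k

  get-set : ∀ a i v → get (set a i v) i ≡ v
  get-set []       zero    v = refl
  get-set []       (suc i) v = get-set [] i v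
  get-set (x ∷ a)  zero    v = refl
  get-set (x ∷ a)  (suc i) v = get-set a i v

  get-set-≢ : ∀ a {i k} v → i ≢ k → get (set a i v) k ≡ get a k
  get-set-≢ a       {zero}  {zero}  v i≢k = contradiction refl i≢k
  get-set-≢ []      {zero}  {suc k} v i≢k = refl
  get-set-≢ (x ∷ a) {zero}  {suc k} v i≢k = refl
  get-set-≢ []      {suc i} {zero}  v i≢k = refl
  get-set-≢ (x ∷ a) {suc i} {zero}  v i≢k = refl
  get-set-≢ []      {suc i} {suc k} v i≢k = get-set-≢ [] v (i≢k ∘ cong suc)
  get-set-≢ (x ∷ a) {suc i} {suc k} v i≢k = get-set-≢ a v (i≢k ∘ cong suc)

  set-set : ∀ a i u v → set (set a i u) i v ≡ set a i v
  set-set []      zero    u v = refl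
  set-set []      (suc i) u v = cong (0 ∷_) (set-set [] i u v)
  set-set (x ∷ a) zero    u v = refl
  set-set (x ∷ a) (suc i) u v = cong (x ∷_) (set-set a i u v)

  set-comm : ∀ a {i j} u v → i ≢ j → set (set a i u) j v ≡ set (set a j v) i u
  set-comm a       {zero}  {zero}  u v i≢j = contradiction refl i≢j
  set-comm []      {zero}  {suc j} u v i≢j = refl
  set-comm (x ∷ a) {zero}  {suc j} u v i≢j = refl
  set-comm []      {suc i} {zero}  u v i≢j = refl
  set-comm (x ∷ a) {suc i} {zero}  u v i≢j = refl
  set-comm []      {suc i} {suc j} u v i≢j = cong (0 ∷_) (set-comm [] u v (i≢j ∘ cong suc))
  set-comm (x ∷ a) {suc i} {suc j} u v i≢j = cong (x ∷_) (set-comm a u v (i≢j ∘ cong suc))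

  put : ℕ → List ℕ → ℕ → ℕ → List ℕ
  put i a x y = set (set a i x) (suc i) y

  get-putˡ : ∀ i a x y → get (put i a x y) i ≡ x
  get-putˡ i a x y = trans (get-set-≢ (set a i x) y ℕ.1+n≢n) (get-set a i x)

  get-putʳ : ∀ i a x y → get (put i a x y) (suc i) ≡ y
  get-putʳ i a x y = get-set (set a i x) (suc i) y

  get-put-≢ : ∀ i a x y {k} → i ≢ k → suc i ≢ k → get (put i a x y) k ≡ get a k
  get-put-≢ i a x y i≢k 1+i≢k = trans (get-set-≢ (set a i x) y 1+i≢k) (get-set-≢ a x i≢k)

  put-put : ∀ i a u v x y → put i (put i a u v) x y ≡ put i a x y
  put-put i a u v x y =
    trans (cong (λ b → set b (suc i) y) (set-comm (set a i u) v x ℕ.1+n≢n))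
      (trans (set-set (set (set a i u) i x) (suc i) v y)
        (cong (λ b → set b (suc i) y) (set-set a i u x)))

  ≐-by-cases : ∀ i a b → get a i ≡ get b i → get a (suc i) ≡ get b (suc i) →
    (∀ k → i ≢ k → suc i ≢ k → get a k ≡ get b k) → a ≐ b
  ≐-by-cases i a b eˡ eʳ e k with i ℕ.≟ k | suc i ℕ.≟ k
  ... | yes refl | _        = eˡ
  ... | no _     | yes refl = eʳ
  ... | no i≢k   | no 1+i≢k = e k i≢k 1+i≢k

  -- Only up to `≐`: `set` pads a short list with zeros.
  put-get : ∀ i a → put i a (get a i) (get a (suc i)) ≐ a
  put-get i a = ≐-by-cases i (put i a (get a i) (get a (suc i))) a (get-putˡ i a _ _) (get-putʳ i a _ _)
    (λ k → get-put-≢ i a _ _)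

  eqL⇒≡ : ∀ a b → eqL a b ≡ true → a ≡ b
  eqL⇒≡ []      []      e = refl
  eqL⇒≡ (x ∷ a) (y ∷ b) e with x ≡ᵇ y in x≡ᵇy
  ... | true = cong₂ _∷_ (ℕ.≡ᵇ⇒≡ x y (Equivalence.from T-≡ x≡ᵇy)) (eqL⇒≡ a b e)

  eqL-refl : ∀ a → eqL a a ≡ true
  eqL-refl []      = refl
  eqL-refl (x ∷ a) rewrite dec-true (x ℕ.≟ x) refl = eqL-refl a

  get-strip : ∀ a → strip a ≐ a
  get-strip []      k = refl
  get-strip (x ∷ a) k with strip a | get-strip a
  get-strip (zero  ∷ a) zero    | []    | e = refl
  get-strip (zero  ∷ a) (suc k) | []    | e = e k
  get-strip (suc x ∷ a) zero    | []    | e = refl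
  get-strip (suc x ∷ a) (suc k) | []    | e = e k
  get-strip (x ∷ a)     zero    | _ ∷ _ | e = refl
  get-strip (x ∷ a)     (suc k) | _ ∷ _ | e = e k

  strip-zero : ∀ a → [] ≐ a → strip a ≡ []
  strip-zero []      e = refl
  strip-zero (x ∷ a) e rewrite strip-zero a (e ∘ suc) | sym (e 0) = refl

  strip-cong : ∀ a b → a ≐ b → strip a ≡ strip b
  strip-cong []      b       e = sym (strip-zero b e)
  strip-cong (x ∷ a) []      e = strip-zero (x ∷ a) (sym ∘ e)
  strip-cong (x ∷ a) (y ∷ b) e rewrite strip-cong a b (e ∘ suc) | e 0 = refl

  -- The test inside `coeff` ignores trailing zeros exactly as `≐` does, so exponent vectors can be
  -- handled through `get` alone.
  eqL-strip⇔ : ∀ a b → eqL (strip a) (strip b) ≡ true ⇔ a ≐ b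
  eqL-strip⇔ a b = mk⇔
    (λ e k → trans (sym (get-strip a k))
      (trans (cong (λ s → get s k) (eqL⇒≡ (strip a) (strip b) e)) (get-strip b k)))
    (λ e → trans (cong (λ s → eqL s (strip b)) (strip-cong a b e)) (eqL-refl (strip b)))

  -- Coefficients of divided differences

  infix 4 _≋_
  -- A record, because `_≈P_` unfolds to equations between coefficients from which unification
  -- cannot recover the two polynomials.
  record _≋_ (f g : Poly) : Set where
    constructor coefficientwise
    field coefficients : f ≈P g

  open _≋_ public

  ≋-setoid : Setoid 0ℓ 0ℓ
  ≋-setoid = record
    { Carrier       = Poly
    ; _≈_           = _≋_
    ; isEquivalence = record
      { refl  = coefficientwise λ μ → refl
      ; sym   = λ (coefficientwise e) → coefficientwise λ μ → sym (e μ)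
      ; trans = λ (coefficientwise e) (coefficientwise e′) → coefficientwise λ μ → trans (e μ) (e′ μ)
      }
    }

  coeff-resp : ∀ f μ ν → μ ≐ ν → coeff f μ ≡ coeff f ν
  coeff-resp []            μ ν e = refl
  coeff-resp ((c , a) ∷ f) μ ν e =
    cong₂ _+_ (cong (λ s → if eqL (strip a) s then c else 0ℤ) (strip-cong μ ν e)) (coeff-resp f μ ν e)

  coeff-++ : ∀ f g μ → coeff (f ++ g) μ ≡ coeff f μ + coeff g μ
  coeff-++ []            g μ = sym (+-identityˡ _)
  coeff-++ ((c , a) ∷ f) g μ =
    trans (cong (t +_) (coeff-++ f g μ)) (sym (+-assoc t (coeff f μ) (coeff g μ)))
    where t = if eqL (strip a) (strip μ) then c else 0ℤ

  infix 4 _≃T_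
  _≃T_ : Term → Term → Set
  (c , a) ≃T (d , b) = c ≡ d × a ≐ b

  pointwise⇒≋ : ∀ {f g} → Pointwise _≃T_ f g → f ≋ g
  pointwise⇒≋ []                                                 = coefficientwise λ μ → refl
  pointwise⇒≋ {(c , a) ∷ f} {(_ , b) ∷ g} ((refl , e) ∷ es) = coefficientwise λ μ →
    cong₂ _+_ (cong (λ s → if eqL s (strip μ) then c else 0ℤ) (strip-cong a b e))
      (coefficients (pointwise⇒≋ es) μ)

  indicator : ℤ → ℕ → ℕ → ℕ → ℕ → ℤ
  indicator e u v x y = if (u ≡ᵇ x) ∧ (v ≡ᵇ y) then e else 0ℤ

  agreeOff : ℕ → List ℕ → List ℕ → Bool
  agreeOff i a μ = eqL (strip (put i a 0 0)) (strip (put i μ 0 0))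

  eqL-split : ∀ i a μ → eqL (strip a) (strip μ) ≡
    ((get a i ≡ᵇ get μ i) ∧ (get a (suc i) ≡ᵇ get μ (suc i))) ∧ agreeOff i a μ
  eqL-split i a μ = ⇔→≡ (mk⇔ to from)
    where
    split : Bool
    split = ((get a i ≡ᵇ get μ i) ∧ (get a (suc i) ≡ᵇ get μ (suc i))) ∧ agreeOff i a μ
    to′ : a ≐ μ → split ≡ true
    to′ e rewrite dec-true (get a i ℕ.≟ get μ i) (e i)
               | dec-true (get a (suc i) ℕ.≟ get μ (suc i)) (e (suc i)) =
      Equivalence.from (eqL-strip⇔ (put i a 0 0) (put i μ 0 0))
        (≐-by-cases i (put i a 0 0) (put i μ 0 0)
          (trans (get-putˡ i a 0 0) (sym (get-putˡ i μ 0 0)))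
          (trans (get-putʳ i a 0 0) (sym (get-putʳ i μ 0 0)))
          (λ k i≢k 1+i≢k → trans (get-put-≢ i a 0 0 i≢k 1+i≢k)
            (trans (e k) (sym (get-put-≢ i μ 0 0 i≢k 1+i≢k)))))
    to : eqL (strip a) (strip μ) ≡ true → split ≡ true
    to e = to′ (Equivalence.to (eqL-strip⇔ a μ) e)
    from : split ≡ true → eqL (strip a) (strip μ) ≡ true
    from e with Equivalence.to T-∧ (Equivalence.from T-≡ e)
    ... | t , t₃ with Equivalence.to T-∧ t
    ...   | t₁ , t₂ = Equivalence.from (eqL-strip⇔ a μ)
      (≐-by-cases i a μ (ℕ.≡ᵇ⇒≡ _ _ t₁) (ℕ.≡ᵇ⇒≡ _ _ t₂) λ k i≢k 1+i≢k →
        trans (sym (get-put-≢ i a 0 0 i≢k 1+i≢k))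
          (trans (Equivalence.to (eqL-strip⇔ (put i a 0 0) (put i μ 0 0)) (Equivalence.to T-≡ t₃) k)
            (get-put-≢ i μ 0 0 i≢k 1+i≢k)))

  if-∧ : ∀ b b′ (c : ℤ) → (if b ∧ b′ then c else 0ℤ) ≡ (if b then (if b′ then c else 0ℤ) else 0ℤ)
  if-∧ true  b′ c = refl
  if-∧ false b′ c = refl

  term-coeff : ∀ i c a μ x y →
    (if eqL (strip a) (strip (put i μ x y)) then c else 0ℤ) ≡
    indicator (if agreeOff i a μ then c else 0ℤ) (get a i) (get a (suc i)) x y
  term-coeff i c a μ x y
    rewrite eqL-split i a (put i μ x y) | get-putˡ i μ x y | get-putʳ i μ x y | put-put i μ x y 0 0 =
    if-∧ ((get a i ≡ᵇ x) ∧ (get a (suc i) ≡ᵇ y)) (agreeOff i a μ) c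

  put-term-coeff : ∀ i c a u v μ x y →
    (if eqL (strip (put i a u v)) (strip (put i μ x y)) then c else 0ℤ) ≡
    indicator (if agreeOff i a μ then c else 0ℤ) u v x y
  put-term-coeff i c a u v μ x y
    rewrite term-coeff i c (put i a u v) μ x y
          | get-putˡ i a u v | get-putʳ i a u v | put-put i a u v 0 0 = refl

  -- Geometric sums and the characterization of `∂`

  Σ< : ℕ → (ℕ → ℤ) → ℤ
  Σ< zero    g = 0ℤ
  Σ< (suc d) g = g 0 + Σ< d (g ∘ suc)

  Σ<-cong : ∀ d {g h : ℕ → ℤ} → (∀ k → g k ≡ h k) → Σ< d g ≡ Σ< d h
  Σ<-cong zero    e = refl
  Σ<-cong (suc d) e = cong₂ _+_ (e 0) (Σ<-cong d (e ∘ suc))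

  mulDiff-add : ∀ (G H : ℕ → ℕ → ℤ) x y →
    mulDiff (λ u v → G u v + H u v) x y ≡ mulDiff G x y + mulDiff H x y
  mulDiff-add G H x y
    rewrite shift-add (λ u → G u y) (λ u → H u y) x | shift-add (G x) (H x) y =
    lem (shift (λ u → G u y) x) (shift (λ u → H u y) x) (shift (G x) y) (shift (H x) y)
    where
    lem : ∀ p q r s → (p + q) - (r + s) ≡ (p - r) + (q - s)
    lem = solve-∀

  shift-zero : ∀ k → shift (λ _ → 0ℤ) k ≡ 0ℤ
  shift-zero zero    = refl
  shift-zero (suc k) = refl

  mulDiff-indicator : ∀ e u v x y →
    mulDiff (indicator e u v) x y ≡ indicator e (suc u) v x y - indicator e u (suc v) x y
  mulDiff-indicator e u v x y = cong₂ _-_ (lemˡ x) (lemʳ y)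
    where
    lemˡ : ∀ x → shift (λ x → indicator e u v x y) x ≡ indicator e (suc u) v x y
    lemˡ zero    = refl
    lemˡ (suc x) = refl
    lemʳ : ∀ y → shift (indicator e u v x) y ≡ indicator e u (suc v) x y
    lemʳ zero rewrite ∧-zeroʳ (u ≡ᵇ x) = refl
    lemʳ (suc y) = refl

  -- This is (x - y) Σ x^k y^(d-1-k) = x^d - y^d, multiplied by x^u y^v. Splitting off k = 0 leaves
  -- a sum of the same kind with u raised by one, hence the general u.
  telescope : ∀ e d u v x y →
    mulDiff (λ x y → Σ< d (λ k → indicator e (u ℕ.+ k) (v ℕ.+ (d ∸ 1 ∸ k)) x y)) x y ≡
    indicator e (u ℕ.+ d) v x y - indicator e u (v ℕ.+ d) x y
  telescope e zero u v x y
    rewrite shift-zero x | shift-zero y | ℕ.+-identityʳ u | ℕ.+-identityʳ v =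
    sym (+-inverseʳ (indicator e u v x y))
  telescope e (suc d) u v x y = begin
    mulDiff (λ x y → indicator e (u ℕ.+ 0) (v ℕ.+ d) x y +
        Σ< d (λ k → indicator e (u ℕ.+ suc k) (v ℕ.+ (d ∸ suc k)) x y)) x y
      ≡⟨ mulDiff-cong (λ x y → cong₂ _+_ (cong (λ t → indicator e t (v ℕ.+ d) x y) (ℕ.+-identityʳ u))
           (Σ<-cong d λ k → cong₂ (λ s t → indicator e s (v ℕ.+ t) x y) (ℕ.+-suc u k)
             (sym (ℕ.∸-+-assoc d 1 k)))) x y ⟩
    mulDiff (λ x y → indicator e u (v ℕ.+ d) x y +
        Σ< d (λ k → indicator e (suc u ℕ.+ k) (v ℕ.+ (d ∸ 1 ∸ k)) x y)) x y
      ≡⟨ mulDiff-add (indicator e u (v ℕ.+ d)) _ x y ⟩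
    mulDiff (indicator e u (v ℕ.+ d)) x y +
    mulDiff (λ x y → Σ< d (λ k → indicator e (suc u ℕ.+ k) (v ℕ.+ (d ∸ 1 ∸ k)) x y)) x y
      ≡⟨ cong₂ _+_ (mulDiff-indicator e u (v ℕ.+ d) x y) (telescope e d (suc u) v x y) ⟩
    (indicator e (suc u) (v ℕ.+ d) x y - indicator e u (suc (v ℕ.+ d)) x y) +
    (indicator e (suc u ℕ.+ d) v x y - indicator e (suc u) (v ℕ.+ d) x y)
      ≡⟨ lem (indicator e (suc u) (v ℕ.+ d) x y) (indicator e u (suc (v ℕ.+ d)) x y)
           (indicator e (suc u ℕ.+ d) v x y) ⟩
    indicator e (suc u ℕ.+ d) v x y - indicator e u (suc (v ℕ.+ d)) x y
      ≡⟨ cong₂ (λ s t → indicator e s v x y - indicator e u t x y) (sym (ℕ.+-suc u d)) (sym (ℕ.+-suc v d)) ⟩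
    indicator e (u ℕ.+ suc d) v x y - indicator e u (v ℕ.+ suc d) x y ∎
    where
    open ≡-Reasoning
    lem : ∀ p q r → (p - q) + (r - p) ≡ r - q
    lem = solve-∀

  indicator-swap : ∀ e u v x y → indicator e u v x y ≡ indicator e v u y x
  indicator-swap e u v x y = cong (if_then e else 0ℤ) (∧-comm (u ≡ᵇ x) (v ≡ᵇ y))

  indicator-neg : ∀ e u v x y → indicator (- e) u v x y ≡ - indicator e u v x y
  indicator-neg e u v x y with (u ≡ᵇ x) ∧ (v ≡ᵇ y)
  ... | true  = refl
  ... | false = refl

  quotient-indicator : ∀ e p q → Quotient (indicator e p q) (λ x y →
    Σ< ((p ∸ q) ℕ.+ (q ∸ p)) (λ k → indicator (if q <ᵇ p then e else - e)
      ((if p ≤ᵇ q then p else q) ℕ.+ k)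
      ((if p ≤ᵇ q then p else q) ℕ.+ ((p ∸ q) ℕ.+ (q ∸ p) ∸ 1 ∸ k)) x y))
  quotient-indicator e p q with ℕ.≤-<-connex p q
  ... | inj₁ p≤q rewrite dec-true (p ℕ.≤? q) p≤q | dec-false (q ℕ.<? p) (ℕ.≤⇒≯ p≤q)
                       | ℕ.m≤n⇒m∸n≡0 p≤q = quotient pf
    where
    lem : ∀ s t → - s - (- t) ≡ t - s
    lem = solve-∀
    -- For p ≤ q the geometric sum yields x^q y^p - x^p y^q, hence the sign. The case p = q is
    -- included: the sum is empty and the difference vanishes.
    pf : ∀ x y → mulDiff (λ x y → Σ< (q ∸ p) (λ k →
      indicator (- e) (p ℕ.+ k) (p ℕ.+ (q ∸ p ∸ 1 ∸ k)) x y)) x y ≡ indicator e p q x y - indicator e p q y x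
    pf x y rewrite telescope (- e) (q ∸ p) p p x y | ℕ.m+[n∸m]≡n p≤q
                 | indicator-neg e q p x y | indicator-neg e p q x y
                 | indicator-swap e p q y x = lem (indicator e q p x y) (indicator e p q x y)
  ... | inj₂ q<p rewrite dec-false (p ℕ.≤? q) (ℕ.<⇒≱ q<p) | dec-true (q ℕ.<? p) q<p
                       | ℕ.m≤n⇒m∸n≡0 (ℕ.<⇒≤ q<p) | ℕ.+-identityʳ (p ∸ q) = quotient pf
    where
    pf : ∀ x y → mulDiff (λ x y → Σ< (p ∸ q) (λ k →
      indicator e (q ℕ.+ k) (q ℕ.+ (p ∸ q ∸ 1 ∸ k)) x y)) x y ≡ indicator e p q x y - indicator e p q y x
    pf x y rewrite telescope e (p ∸ q) q q x y | ℕ.m+[n∸m]≡n (ℕ.<⇒≤ q<p)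
                 | indicator-swap e p q y x = refl

  sum-map-applyUpTo : ∀ (g : ℕ → ℤ) h d → sumℤ (map g (applyUpTo h d)) ≡ Σ< d (g ∘ h)
  sum-map-applyUpTo g h zero    = refl
  sum-map-applyUpTo g h (suc d) = cong (g (h 0) +_) (sum-map-applyUpTo g (h ∘ suc) d)

  coeff-put-terms : ∀ i c a (u v : ℕ → ℕ) ks μ x y →
    coeff (map (λ k → c , put i a (u k) (v k)) ks) (put i μ x y) ≡
    sumℤ (map (λ k → indicator (if agreeOff i a μ then c else 0ℤ) (u k) (v k) x y) ks)
  coeff-put-terms i c a u v []       μ x y = refl
  coeff-put-terms i c a u v (k ∷ ks) μ x y =
    cong₂ _+_ (put-term-coeff i c a (u k) (v k) μ x y) (coeff-put-terms i c a u v ks μ x y)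

  if-sign : ∀ b s (c : ℤ) → (if b then (if s then c else - c) else 0ℤ) ≡
    (if s then (if b then c else 0ℤ) else - (if b then c else 0ℤ))
  if-sign true  true  c = refl
  if-sign true  false c = refl
  if-sign false true  c = refl
  if-sign false false c = refl

  quotient-resp : ∀ {F F′ G G′} → (∀ x y → F x y ≡ F′ x y) → (∀ x y → G x y ≡ G′ x y) →
    Quotient F G → Quotient F′ G′
  quotient-resp eF eG (quotient q) = quotient λ x y →
    trans (sym (mulDiff-cong eG x y)) (trans (q x y) (cong₂ _-_ (eF x y) (eF y x)))

  quotient-add : ∀ {F F′ G G′} → Quotient F G → Quotient F′ G′ →
    Quotient (λ x y → F x y + F′ x y) (λ x y → G x y + G′ x y)
  quotient-add {F} {F′} {G} {G′} (quotient q) (quotient q′) = quotient λ x y →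
    trans (mulDiff-add G G′ x y) (trans (cong₂ _+_ (q x y) (q′ x y))
      (lem (F x y) (F y x) (F′ x y) (F′ y x)))
    where
    lem : ∀ p q r s → (p - q) + (r - s) ≡ (p + r) - (q + s)
    lem = solve-∀

  ∂term-quotient : ∀ i c a μ → Quotient
    (λ x y → if eqL (strip a) (strip (put i μ x y)) then c else 0ℤ)
    (λ x y → coeff (∂term i (c , a)) (put i μ x y))
  ∂term-quotient i c a μ = quotient-resp
    (λ x y → sym (term-coeff i c a μ x y))
    (λ x y → sym (trans
      (coeff-put-terms i (if q <ᵇ p then c else - c) a (lo ℕ.+_) (λ k → lo ℕ.+ (d ∸ 1 ∸ k)) (upTo d) μ x y)
      (trans (sum-map-applyUpTo _ id d)
        (Σ<-cong d λ k → cong (λ e → indicator e (lo ℕ.+ k) (lo ℕ.+ (d ∸ 1 ∸ k)) x y)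
          (if-sign (agreeOff i a μ) (q <ᵇ p) c)))))
    (quotient-indicator (if agreeOff i a μ then c else 0ℤ) p q)
    where
    p  = get a i
    q  = get a (suc i)
    lo = if p ≤ᵇ q then p else q
    d  = (p ∸ q) ℕ.+ (q ∸ p)

  -- The bridge from the termwise `∂` to (f - s_i f)/(x_i - x_{i+1}). The congruence and the
  -- relations below draw on no other property of `∂`.
  ∂-quotient : ∀ i f μ →
    Quotient (λ x y → coeff f (put i μ x y)) (λ x y → coeff (∂ i f) (put i μ x y))
  ∂-quotient i []            μ = quotient λ x y → cong₂ _-_ (shift-zero x) (shift-zero y)
  ∂-quotient i ((c , a) ∷ f) μ = quotient-resp (λ x y → refl)
    (λ x y → sym (coeff-++ (∂term i (c , a)) (∂ i f) (put i μ x y)))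
    (quotient-add (∂term-quotient i c a μ) (∂-quotient i f μ))

  -- Equal coefficients give no matching of terms; uniqueness of the quotient takes its place.
  ∂-cong : ∀ i {f g} → f ≋ g → ∂ i f ≋ ∂ i g
  ∂-cong i {f} {g} (coefficientwise e) = coefficientwise λ μ →
    trans (sym (coeff-resp (∂ i f) (put i μ (get μ i) (get μ (suc i))) μ (put-get i μ)))
    (trans (quotient-unique (λ x y → e (put i μ x y)) (∂-quotient i f μ) (∂-quotient i g μ)
              (get μ i) (get μ (suc i)))
      (coeff-resp (∂ i g) (put i μ (get μ i) (get μ (suc i))) μ (put-get i μ)))

  -- Commutation and braid relations

  put-comm : ∀ {i j} μ x y z w → suc i < j → put j (put i μ x y) z w ≡ put i (put j μ z w) x y
  put-comm {i} {j} μ x y z w 1+i<j = begin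
    set (set (set (set μ i x) (suc i) y) j z) (suc j) w
      ≡⟨ cong (λ a → set a (suc j) w) (set-comm (set μ i x) y z (ℕ.<⇒≢ 1+i<j)) ⟩
    set (set (set (set μ i x) j z) (suc i) y) (suc j) w
      ≡⟨ set-comm (set (set μ i x) j z) y w (ℕ.<⇒≢ (ℕ.m<n⇒m<1+n 1+i<j)) ⟩
    set (set (set (set μ i x) j z) (suc j) w) (suc i) y
      ≡⟨ cong (λ a → set (set a (suc j) w) (suc i) y) (set-comm μ x z (ℕ.<⇒≢ i<j)) ⟩
    set (set (set (set μ j z) i x) (suc j) w) (suc i) y
      ≡⟨ cong (λ a → set a (suc i) y) (set-comm (set μ j z) x w (ℕ.<⇒≢ (ℕ.m<n⇒m<1+n i<j))) ⟩
    set (set (set (set μ j z) (suc j) w) i x) (suc i) y ∎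
    where
    open ≡-Reasoning
    i<j = ℕ.<-trans (ℕ.n<1+n i) 1+i<j

  ∂-comm : ∀ {i j} f → suc i < j → ∂ j (∂ i f) ≋ ∂ i (∂ j f)
  ∂-comm {i} {j} f 1+i<j = coefficientwise λ μ → let open At μ in begin
    coeff (∂ j (∂ i f)) μ
      ≡⟨ coeff-resp (∂ j (∂ i f)) ν μ restored ⟨
    coeff (∂ j (∂ i f)) ν
      ≡⟨ quotient-comm (λ z w → inner f z w) (λ x y → ∂-quotient j (∂ i f) (put i μ x y))
           (λ x y → ∂-quotient j f (put i μ x y)) (λ z w → inner (∂ j f) z w)
           (get μ i) (get μ (suc i)) (get μ′ j) (get μ′ (suc j)) ⟩
    coeff (∂ i (∂ j f)) ν
      ≡⟨ coeff-resp (∂ i (∂ j f)) ν μ restored ⟩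
    coeff (∂ i (∂ j f)) μ ∎
    where
    open ≡-Reasoning
    module At (μ : List ℕ) where
      μ′ = put i μ (get μ i) (get μ (suc i))
      ν  = put j μ′ (get μ′ j) (get μ′ (suc j))
      restored : ν ≐ μ
      restored k = trans (put-get j μ′ k) (put-get i μ k)
      inner : ∀ f z w → Quotient (λ x y → coeff f (put j (put i μ x y) z w))
                                 (λ x y → coeff (∂ i f) (put j (put i μ x y) z w))
      inner f z w = quotient-resp
        (λ x y → cong (coeff f) (sym (put-comm μ x y z w 1+i<j)))
        (λ x y → cong (coeff (∂ i f)) (sym (put-comm μ x y z w 1+i<j)))
        (∂-quotient i f (put j μ z w))

  ∂-braid : ∀ i f → ∂ i (∂ (suc i) (∂ i f)) ≋ ∂ (suc i) (∂ i (∂ (suc i) f))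
  ∂-braid i f = coefficientwise λ μ → let open At μ in begin
    coeff (∂ i (∂ (suc i) (∂ i f))) μ
      ≡⟨ coeff-resp (∂ i (∂ (suc i) (∂ i f))) (put₃ x y z) μ restored ⟨
    coeff (∂ i (∂ (suc i) (∂ i f))) (put₃ x y z)
      ≡⟨ quotient-braid (first f) (second (∂ i f)) (first (∂ (suc i) (∂ i f)))
           (second f) (first (∂ (suc i) f)) (second (∂ i (∂ (suc i) f))) x y z ⟩
    coeff (∂ (suc i) (∂ i (∂ (suc i) f))) (put₃ x y z)
      ≡⟨ coeff-resp (∂ (suc i) (∂ i (∂ (suc i) f))) (put₃ x y z) μ restored ⟩
    coeff (∂ (suc i) (∂ i (∂ (suc i) f))) μ ∎
    where
    open ≡-Reasoning
    module At (μ : List ℕ) where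
      -- This order of updates makes `put₃` a `put (suc i)` by definition, so `second` is immediate
      -- and only `first` needs the rearrangement `put₃≡`.
      put₃ : ℕ → ℕ → ℕ → List ℕ
      put₃ x y z = put (suc i) (set μ i x) y z
      x = get μ i
      y = get (set μ i x) (suc i)
      z = get (set μ i x) (suc (suc i))
      restored : put₃ x y z ≐ μ
      restored k = trans (put-get (suc i) (set μ i x) k) (set-get k)
        where
        set-get : set μ i x ≐ μ
        set-get k with i ℕ.≟ k
        ... | yes refl = get-set μ i x
        ... | no i≢k   = get-set-≢ μ x i≢k
      put₃≡ : ∀ x y z → put i (set μ (suc (suc i)) z) x y ≡ put₃ x y z
      put₃≡ x y z =
        trans (cong (λ a → set a (suc i) y) (set-comm μ z x (ℕ.<⇒≢ (ℕ.m<n⇒m<1+n (ℕ.n<1+n i)) ∘ sym)))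
          (set-comm (set μ i x) z y ℕ.1+n≢n)
      first : ∀ f z → Quotient (λ x y → coeff f (put₃ x y z)) (λ x y → coeff (∂ i f) (put₃ x y z))
      first f z = quotient-resp (λ x y → cong (coeff f) (put₃≡ x y z))
        (λ x y → cong (coeff (∂ i f)) (put₃≡ x y z))
        (∂-quotient i f (set μ (suc (suc i)) z))
      second : ∀ f x → Quotient (λ y z → coeff f (put₃ x y z)) (λ y z → coeff (∂ (suc i) f) (put₃ x y z))
      second f x = ∂-quotient (suc i) f (set μ i x)

open DividedDifferences
open import Data.Nat using (_+_; _*_)
open import Data.Nat.Tactic.RingSolver using (solve-∀)

-- The Schubert recursion at an arbitrary ascent

firstAscent′ : List ℕ → Maybe ℕ
firstAscent′ []           = nothing
firstAscent′ (x ∷ [])     = nothing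
firstAscent′ (x ∷ y ∷ ys) = if x <ᵇ y then just 0 else Maybe.map suc (firstAscent′ (y ∷ ys))

step : ℕ → ℕ → Maybe ℕ → Maybe ℕ
step x y r = if x <ᵇ y then just 0 else Maybe.map suc r

firstAscent≡ : ∀ w → firstAscent w ≡ firstAscent′ w
-- The local function go of firstAscent depends on the whole list and cannot be
-- named, so the metavariable stands for it. It is solved where go≡ is used:
-- abstracting y ∷ ys and Maybe.map suc leaves go applied to variables.
go≡ : (x : ℕ) (xs : List ℕ) (y : ℕ) (ys : List ℕ) → _ ≡ firstAscent′ (y ∷ ys)

firstAscent≡ []       = refl
firstAscent≡ (x ∷ []) = refl
firstAscent≡ (x ∷ y ∷ ys) with y ∷ ys in e | Maybe.map {A = ℕ} ℕ.suc
... | zs | h = trans (cong (λ r → if x <ᵇ y then just 0 else h r) (go≡ x zs y ys))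
                 (cong (λ l → if x <ᵇ y then just 0 else h (firstAscent′ l)) e)

go≡ x xs y []       = refl
go≡ x xs y (z ∷ zs) = cong (step y z) (go≡ x xs z zs)

data Ascent : ℕ → List ℕ → Set where
  here  : ∀ {x y xs} → x < y → Ascent 0 (x ∷ y ∷ xs)
  there : ∀ {i x xs} → Ascent i xs → Ascent (suc i) (x ∷ xs)

data FirstAscent : ℕ → List ℕ → Set where
  here  : ∀ {x y xs} → x < y → FirstAscent 0 (x ∷ y ∷ xs)
  there : ∀ {i x y xs} → y ≤ x → FirstAscent i (y ∷ xs) → FirstAscent (suc i) (x ∷ y ∷ xs)

FirstAscent⇒Ascent : ∀ {i w} → FirstAscent i w → Ascent i w
FirstAscent⇒Ascent (here x<y)  = here x<y
FirstAscent⇒Ascent (there _ p) = there (FirstAscent⇒Ascent p)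

FirstAscent-least : ∀ {i j w} → FirstAscent i w → Ascent j w → i ≤ j
FirstAscent-least (here _)      _         = z≤n
FirstAscent-least (there y≤x _) (here x<y) = contradiction x<y (ℕ.≤⇒≯ y≤x)
FirstAscent-least (there _ p)   (there q) = s≤s (FirstAscent-least p q)

isPartition-∷ : ∀ x y ys → y ≤ x → isPartition (y ∷ ys) ≡ true → isPartition (x ∷ y ∷ ys) ≡ true
isPartition-∷ x y ys y≤x e rewrite dec-true (y ≤? x) y≤x = e

isPartition-uncons : ∀ x y ys → isPartition (x ∷ y ∷ ys) ≡ true → y ≤ x × isPartition (y ∷ ys) ≡ true
isPartition-uncons x y ys e with Equivalence.to T-∧ (Equivalence.from T-≡ e)
... | t₁ , t₂ = ℕ.≤ᵇ⇒≤ y x t₁ , Equivalence.to T-≡ t₂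

isPartition-tail : ∀ x xs → isPartition (x ∷ xs) ≡ true → isPartition xs ≡ true
isPartition-tail x []       e = refl
isPartition-tail x (y ∷ ys) e = proj₂ (isPartition-uncons x y ys e)

isPartition⇒¬Ascent : ∀ {j w} → isPartition w ≡ true → ¬ Ascent j w
isPartition⇒¬Ascent e (here {x} {y} {xs} x<y) = ℕ.<⇒≱ x<y (proj₁ (isPartition-uncons x y xs e))
isPartition⇒¬Ascent e (there {x = x} {xs} p)  = isPartition⇒¬Ascent (isPartition-tail x xs e) p

firstAscent-view : ∀ w → (∃ λ i → firstAscent w ≡ just i × FirstAscent i w) ⊎
                         (firstAscent w ≡ nothing × isPartition w ≡ true)
firstAscent-view w rewrite firstAscent≡ w = view w
  where
  view : ∀ w → (∃ λ i → firstAscent′ w ≡ just i × FirstAscent i w) ⊎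
               (firstAscent′ w ≡ nothing × isPartition w ≡ true)
  view []           = inj₂ (refl , refl)
  view (x ∷ [])     = inj₂ (refl , refl)
  view (x ∷ y ∷ ys) with ℕ.<-≤-connex x y | view (y ∷ ys)
  ... | inj₁ x<y | _ rewrite dec-true (x <? y) x<y = inj₁ (0 , refl , here x<y)
  ... | inj₂ y≤x | inj₁ (i , e , p) rewrite dec-false (x <? y) (ℕ.≤⇒≯ y≤x) | e =
    inj₁ (suc i , refl , there y≤x p)
  ... | inj₂ y≤x | inj₂ (e , q) rewrite dec-false (x <? y) (ℕ.≤⇒≯ y≤x) | e =
    inj₂ (refl , isPartition-∷ x y ys y≤x q)

swapAt-↭ : ∀ {i w} → Ascent i w → swapAt i w ↭ w
swapAt-↭ (here _)          = swap _ _ ↭-refl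
swapAt-↭ (there {x = x} p) = prep x (swapAt-↭ p)

AllPairs-swapAt : ∀ {ℓ} {R : Rel ℕ ℓ} {i w} → Symmetric R → Ascent i w → AllPairs R w → AllPairs R (swapAt i w)
AllPairs-swapAt s (here _)  ((r ∷ rs) ∷ rs′ ∷ rss) = (s r ∷ rs′) ∷ rs ∷ rss
AllPairs-swapAt s (there p) (rs ∷ rss) = All-resp-↭ (↭-sym (swapAt-↭ p)) rs ∷ AllPairs-swapAt s p rss

Unique-swapAt : ∀ {i w} → Ascent i w → Unique w → Unique (swapAt i w)
Unique-swapAt = AllPairs-swapAt ≢-sym

-- Noninversions as the measure of both recursions

countGreater : ℕ → List ℕ → ℕ
countGreater x xs = length (filter (x <?_) xs)

noninversions : List ℕ → ℕ
noninversions []       = 0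
noninversions (x ∷ xs) = countGreater x xs + noninversions xs

-- Only the exchanged pair changes its order: entries to the left see a permutation of the same
-- values, and entries to the right see nothing.
noninversions-swapAt : ∀ {i w} → Ascent i w → noninversions w ≡ suc (noninversions (swapAt i w))
noninversions-swapAt (here {x} {y} {xs} x<y)
  rewrite filter-accept (x <?_) {xs = xs} x<y | filter-reject (y <?_) {xs = xs} (ℕ.<-asym x<y) =
  cong suc (trans (sym (ℕ.+-assoc (countGreater x xs) (countGreater y xs) (noninversions xs)))
    (trans (cong (_+ noninversions xs) (ℕ.+-comm (countGreater x xs) (countGreater y xs)))
      (ℕ.+-assoc (countGreater y xs) (countGreater x xs) (noninversions xs))))
noninversions-swapAt (there {x = x} p)
  rewrite noninversions-swapAt p | ↭-length (filter-↭ (x <?_) (swapAt-↭ p)) = ℕ.+-suc _ _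

noninversions-swapAt-< : ∀ {i w} → Ascent i w → noninversions (swapAt i w) < noninversions w
noninversions-swapAt-< p = ℕ.≤-reflexive (sym (noninversions-swapAt p))

-- Strict, since one unit of fuel is spent on the base case after all swaps. This fails for the
-- empty list, whose fuel is zero; hence the form with a head.
noninversions-bound : ∀ x xs → noninversions (x ∷ xs) < length (x ∷ xs) * length (x ∷ xs)
noninversions-bound x xs = s≤s (ℕ.+-mono-≤ (length-filter (x <?_) xs)
  (ℕ.≤-trans (rest xs) (ℕ.*-monoʳ-≤ (length xs) (ℕ.n≤1+n (length xs)))))
  where
  rest : ∀ xs → noninversions xs ≤ length xs * length xs
  rest []       = z≤n
  rest (x ∷ xs) = ℕ.<⇒≤ (noninversions-bound x xs)

schubFuel-irrelevant : ∀ f g w → noninversions w < f → noninversions w < g → schubFuel f w ≡ schubFuel g w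
schubFuel-irrelevant (suc f) (suc g) w w<f w<g with firstAscent-view w
... | inj₂ (e , _) rewrite e with isPartition (invcode w)
...   | true  = refl
...   | false = refl
schubFuel-irrelevant (suc f) (suc g) w w<f w<g | inj₁ (i , e , p) rewrite e with isPartition (invcode w)
...   | true  = refl
...   | false = cong (∂ i) (schubFuel-irrelevant f g (swapAt i w) (less w<f) (less w<g))
  where
  less : ∀ {f} → noninversions w < suc f → noninversions (swapAt i w) < f
  less w<f = ℕ.<-≤-trans (noninversions-swapAt-< (FirstAscent⇒Ascent p)) (s≤s⁻¹ w<f)

-- With exactly enough fuel, fuel and noninversions drop together, so the defining recursion holds
-- on the nose and not only up to a change of fuel.
𝔖 : List ℕ → Poly
𝔖 w = schubFuel (suc (noninversions w)) w

-- Dominant permutations at their first ascent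

countLess-mono : ∀ {x y} → x ≤ y → ∀ zs → countLess x zs ≤ countLess y zs
countLess-mono x≤y [] = z≤n
countLess-mono {x} {y} x≤y (z ∷ zs) with ℕ.<-≤-connex z x
... | inj₁ z<x rewrite filter-accept (_<? x) {xs = zs} z<x
                     | filter-accept (_<? y) {xs = zs} (ℕ.<-≤-trans z<x x≤y) = s≤s (countLess-mono x≤y zs)
... | inj₂ x≤z rewrite filter-reject (_<? x) {xs = zs} (ℕ.≤⇒≯ x≤z) =
  ℕ.≤-trans (countLess-mono x≤y zs) (weaken (z <? y))
  where
  weaken : Dec (z < y) → countLess y zs ≤ countLess y (z ∷ zs)
  weaken (yes z<y) rewrite filter-accept (_<? y) {xs = zs} z<y = ℕ.n≤1+n _
  weaken (no z≮y)  rewrite filter-reject (_<? y) {xs = zs} z≮y = ℕ.≤-refl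

countLess-swapAt : ∀ {i w} x → Ascent i w → countLess x (swapAt i w) ≡ countLess x w
countLess-swapAt x p = ↭-length (filter-↭ (_<? x) (swapAt-↭ p))

-- The entry before the first ascent is strictly larger than its successor, and so
-- is its inversion count: raising the code at the ascent keeps it decreasing.
dominant-swapAt : ∀ {i w} → Unique w → FirstAscent i w → isPartition (invcode w) ≡ true →
  isPartition (invcode (swapAt i w)) ≡ true ×
  get (invcode w) (suc i) ≡ get (invcode w) i ×
  invcode (swapAt i w) ≡ set (invcode w) i (suc (get (invcode w) i))
dominant-swapAt u (here {x} {y} {xs} x<y) e
  rewrite filter-reject (_<? x) {xs = xs} (ℕ.<-asym x<y) | filter-accept (_<? y) {xs = xs} x<y
  with isPartition-uncons (countLess x xs) (countLess y xs) (invcode xs) e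
-- The code decreases weakly, but x < y forces the count of y to be at least that of x, so the two
-- code entries at an ascent agree.
... | cy≤cx , e′ with ℕ.≤-antisym cy≤cx (countLess-mono (ℕ.<⇒≤ x<y) xs)
...   | cy≡cx rewrite cy≡cx =
  isPartition-∷ (suc (countLess x xs)) (countLess x xs) (invcode xs) (ℕ.n≤1+n _) e′ , refl , refl
dominant-swapAt ((z≢x ∷ _) ∷ u) (there {x = z} {y = x} {xs = y ∷ xs} x≤z (here x<y)) e
  with dominant-swapAt u (here x<y) (isPartition-tail (countLess z (x ∷ y ∷ xs)) (invcode (x ∷ y ∷ xs)) e)
... | e₁ , e₂ , e₃ rewrite countLess-swapAt z (here {xs = xs} x<y) =
  isPartition-∷ (countLess z (x ∷ y ∷ xs)) (countLess y (x ∷ xs)) (countLess x xs ∷ invcode xs) bound e₁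
  , e₂ , cong (countLess z (x ∷ y ∷ xs) ∷_) e₃
  where
  open ℕ.≤-Reasoning
  x<z : x < z
  x<z = ℕ.≤∧≢⇒< x≤z (≢-sym z≢x)
  bound : countLess y (x ∷ xs) ≤ countLess z (x ∷ y ∷ xs)
  bound = begin
    countLess y (x ∷ xs)               ≡⟨ cong (λ c → get c 0) e₃ ⟩
    suc (countLess x (y ∷ xs))         ≤⟨ s≤s (countLess-mono x≤z (y ∷ xs)) ⟩
    suc (countLess z (y ∷ xs))         ≡⟨ cong length (filter-accept (_<? z) {xs = y ∷ xs} x<z) ⟨
    countLess z (x ∷ y ∷ xs)           ∎
dominant-swapAt (_ ∷ u) (there {x = z} {y = x} {xs = y ∷ xs} x≤z (there {i = i} y≤x p)) e
  with isPartition-uncons (countLess z (x ∷ y ∷ xs)) (countLess x (y ∷ xs)) (invcode (y ∷ xs)) e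
... | cx≤cz , e′ with dominant-swapAt u (there y≤x p) e′
...   | e₁ , e₂ , e₃ rewrite countLess-swapAt z (there {x = x} (FirstAscent⇒Ascent p)) =
  isPartition-∷ (countLess z (x ∷ y ∷ xs)) (countLess x (swapAt i (y ∷ xs))) (invcode (swapAt i (y ∷ xs)))
    (subst (_≤ countLess z (x ∷ y ∷ xs)) (sym (countLess-swapAt x (FirstAscent⇒Ascent p))) cx≤cz) e₁
  , e₂ , cong (countLess z (x ∷ y ∷ xs) ∷_) e₃

-- Exponents c + 1 and c differ by one, so the geometric sum has the single term with exponents c
-- and c.
∂-mono-descent : ∀ i a c → get a i ≡ suc c → get a (suc i) ≡ c → ∂ i (mono a) ≋ mono (set a i c)
∂-mono-descent i a c eˡ eʳ
  rewrite eˡ | eʳ | dec-false (suc c ≤? c) (ℕ.<⇒≱ (ℕ.n<1+n c)) | dec-true (c <? suc c) (ℕ.n<1+n c)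
        | ℕ.m+n∸n≡m 1 c | ℕ.m≤n⇒m∸n≡0 (ℕ.n≤1+n c) | ℕ.+-identityʳ c =
  pointwise⇒≋ ((refl , ≐-by-cases i (put i a c c) (set a i c)
    (trans (get-putˡ i a c c) (sym (get-set a i c)))
    (trans (get-putʳ i a c c) (trans (sym eʳ) (sym (get-set-≢ a c (≢-sym ℕ.1+n≢n)))))
    (λ k i≢k 1+i≢k → trans (get-put-≢ i a c c i≢k 1+i≢k) (sym (get-set-≢ a c i≢k)))) ∷ [])

𝔖-dominant : ∀ w → isPartition (invcode w) ≡ true → 𝔖 w ≡ mono (invcode w)
𝔖-dominant w e rewrite e = refl

𝔖-firstAscent : ∀ {i w} → Unique w → firstAscent w ≡ just i → FirstAscent i w →
  𝔖 w ≋ ∂ i (𝔖 (swapAt i w))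
𝔖-firstAscent {i} {w} u eq p with isPartition (invcode w) in e
... | false rewrite eq | noninversions-swapAt (FirstAscent⇒Ascent p) = Setoid.refl ≋-setoid
... | true with dominant-swapAt u p e
...   | e₁ , e₂ , e₃ = begin
  mono code                                  ≈⟨ pointwise⇒≋ ((refl , restore) ∷ []) ⟨
  mono (set (set code i (suc c)) i c)        ≈⟨ ∂-mono-descent i (set code i (suc c)) c (get-set code i (suc c))
                                                 (trans (get-set-≢ code (suc c) (≢-sym ℕ.1+n≢n)) e₂) ⟨
  ∂ i (mono (set code i (suc c)))            ≡⟨ cong (∂ i ∘ mono) e₃ ⟨
  ∂ i (mono (invcode (swapAt i w)))          ≡⟨ cong (∂ i) (𝔖-dominant (swapAt i w) e₁) ⟨
  ∂ i (𝔖 (swapAt i w))                       ∎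
  where
  open SetoidReasoning ≋-setoid
  code = invcode w
  c    = get code i
  restore : set (set code i (suc c)) i c ≐ code
  restore k with i ℕ.≟ k
  ... | yes refl = get-set (set code i (suc c)) i c
  ... | no i≢k   = trans (get-set-≢ (set code i (suc c)) c i≢k) (get-set-≢ code (suc c) i≢k)

-- From the first ascent to every ascent

record DistantAscents (i j : ℕ) (w : List ℕ) : Set where
  field
    ascent-ij : Ascent j (swapAt i w)
    ascent-ji : Ascent i (swapAt j w)
    commute   : swapAt j (swapAt i w) ≡ swapAt i (swapAt j w)

distantAscents : ∀ {i j w} → Ascent i w → Ascent j w → suc i < j → DistantAscents i j w
distantAscents (here x<y) (there (there q)) _ = record
  { ascent-ij = there (there q) ; ascent-ji = here x<y ; commute = refl }
distantAscents (here x<y) (there (here _)) (s<s ())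
distantAscents (there {x = x} p) (there q) 1+i<j = record
  { ascent-ij = there ascent-ij ; ascent-ji = there ascent-ji ; commute = cong (x ∷_) commute }
  where open DistantAscents (distantAscents p q (s<s⁻¹ 1+i<j))

record AdjacentAscents (i : ℕ) (w : List ℕ) : Set where
  field
    ascent₁₂ : Ascent (suc i) (swapAt i w)
    ascent₁₂₁ : Ascent i (swapAt (suc i) (swapAt i w))
    ascent₂₁ : Ascent i (swapAt (suc i) w)
    ascent₂₁₂ : Ascent (suc i) (swapAt i (swapAt (suc i) w))
    braid : swapAt i (swapAt (suc i) (swapAt i w)) ≡ swapAt (suc i) (swapAt i (swapAt (suc i) w))

-- Two adjacent ascents mean x < y < z, and both reduced words of the longest permutation of three
-- letters lead from xyz to zyx through ascents only.
adjacentAscents : ∀ {i w} → Ascent i w → Ascent (suc i) w → AdjacentAscents i w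
adjacentAscents (here x<y) (there (here y<z)) = record
  { ascent₁₂ = there (here (ℕ.<-trans x<y y<z)) ; ascent₁₂₁ = here y<z
  ; ascent₂₁ = here (ℕ.<-trans x<y y<z) ; ascent₂₁₂ = there (here x<y) ; braid = refl }
adjacentAscents (there {x = x} p) (there q) = record
  { ascent₁₂ = there ascent₁₂ ; ascent₁₂₁ = there ascent₁₂₁
  ; ascent₂₁ = there ascent₂₁ ; ascent₂₁₂ = there ascent₂₁₂ ; braid = cong (x ∷_) braid }
  where open AdjacentAscents (adjacentAscents p q)

-- The bound n makes the claim available, at any ascent, for all permutations reached from `w` by
-- swaps at ascents. For `w` itself the first ascent i ≤ j suffices: the paths through i and through
-- j meet again after a commutation or a braid.
𝔖-ascent-< : ∀ n {j} w → noninversions w < n → Unique w → Ascent j w → 𝔖 w ≋ ∂ j (𝔖 (swapAt j w))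
𝔖-ascent-< (suc n) {j} w w<n u q with firstAscent-view w
... | inj₂ (_ , e) = contradiction q (isPartition⇒¬Ascent e)
... | inj₁ (i , e , p) with ℕ.m≤n⇒m<n∨m≡n (FirstAscent-least p q)
...   | inj₂ refl = 𝔖-firstAscent u e p
...   | inj₁ i<j with ℕ.m≤n⇒m<n∨m≡n i<j
...     | inj₁ 1+i<j = begin
  𝔖 w                                   ≈⟨ 𝔖-firstAscent u e p ⟩
  ∂ i (𝔖 (swapAt i w))                  ≈⟨ ∂-cong i (𝔖-ascent-< n (swapAt i w) (less p′) (Unique-swapAt p′ u) ascent-ij) ⟩
  ∂ i (∂ j (𝔖 (swapAt j (swapAt i w)))) ≈⟨ ∂-comm (𝔖 (swapAt j (swapAt i w))) 1+i<j ⟨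
  ∂ j (∂ i (𝔖 (swapAt j (swapAt i w)))) ≡⟨ cong (∂ j ∘ ∂ i ∘ 𝔖) commute ⟩
  ∂ j (∂ i (𝔖 (swapAt i (swapAt j w)))) ≈⟨ ∂-cong j (𝔖-ascent-< n (swapAt j w) (less q) (Unique-swapAt q u) ascent-ji) ⟨
  ∂ j (𝔖 (swapAt j w))                  ∎
  where
  open SetoidReasoning ≋-setoid
  p′ = FirstAscent⇒Ascent p
  open DistantAscents (distantAscents p′ q 1+i<j)
  less : ∀ {k} → Ascent k w → noninversions (swapAt k w) < n
  less r = ℕ.<-≤-trans (noninversions-swapAt-< r) (s≤s⁻¹ w<n)
...     | inj₂ refl = begin
  𝔖 w
    ≈⟨ 𝔖-firstAscent u e p ⟩
  ∂ i (𝔖 w₁)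
    ≈⟨ ∂-cong i (𝔖-ascent-< n w₁ less₁ u₁ ascent₁₂) ⟩
  ∂ i (∂ j (𝔖 w₁₂))
    ≈⟨ ∂-cong i (∂-cong j (𝔖-ascent-< n w₁₂ (ℕ.<-trans (noninversions-swapAt-< ascent₁₂) less₁)
         (Unique-swapAt ascent₁₂ u₁) ascent₁₂₁)) ⟩
  ∂ i (∂ j (∂ i (𝔖 (swapAt i w₁₂))))
    ≈⟨ ∂-braid i (𝔖 (swapAt i w₁₂)) ⟩
  ∂ j (∂ i (∂ j (𝔖 (swapAt i w₁₂))))
    ≡⟨ cong (∂ j ∘ ∂ i ∘ ∂ j ∘ 𝔖) braid ⟩
  ∂ j (∂ i (∂ j (𝔖 (swapAt j w₂₁))))
    ≈⟨ ∂-cong j (∂-cong i (𝔖-ascent-< n w₂₁ (ℕ.<-trans (noninversions-swapAt-< ascent₂₁) less₂)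
         (Unique-swapAt ascent₂₁ u₂) ascent₂₁₂)) ⟨
  ∂ j (∂ i (𝔖 w₂₁))
    ≈⟨ ∂-cong j (𝔖-ascent-< n w₂ less₂ u₂ ascent₂₁) ⟨
  ∂ j (𝔖 w₂) ∎
  where
  open SetoidReasoning ≋-setoid
  p′  = FirstAscent⇒Ascent p
  w₁  = swapAt i w
  w₁₂ = swapAt j w₁
  w₂  = swapAt j w
  w₂₁ = swapAt i w₂
  u₁ : Unique w₁
  u₁ = Unique-swapAt p′ u
  u₂ : Unique w₂
  u₂ = Unique-swapAt q u
  open AdjacentAscents (adjacentAscents p′ q)
  less₁ : noninversions w₁ < n
  less₁ = ℕ.<-≤-trans (noninversions-swapAt-< p′) (s≤s⁻¹ w<n)
  less₂ : noninversions w₂ < n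
  less₂ = ℕ.<-≤-trans (noninversions-swapAt-< q) (s≤s⁻¹ w<n)

𝔖-ascent : ∀ {j} w → Unique w → Ascent j w → 𝔖 w ≋ ∂ j (𝔖 (swapAt j w))
𝔖-ascent w = 𝔖-ascent-< (suc (noninversions w)) w (ℕ.n<1+n _)

-- Membership supplies nonemptiness: on the empty list `schubert` has no fuel and returns the empty
-- sum, whereas `𝔖` is 1.
schubert≡𝔖 : ∀ {v w} → v ∈ w → schubert w ≡ 𝔖 w
schubert≡𝔖 {w = x ∷ w} _ = schubFuel-irrelevant _ _ (x ∷ w) (noninversions-bound x w) (ℕ.n<1+n _)

-- The reflection r_{m,n} exchanges π̂ and ∂

-- The geometric sum in the divided difference of a monomial whose exponents at
-- i and i + 1 are lo and lo + d in some order.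
run : ℕ → ℤ → List ℕ → ℕ → ℕ → Poly
run i c a lo d = map (λ k → c , put i a (lo + k) (lo + (d ∸ 1 ∸ k))) (upTo d)

-- Equal exponents fall under `up` with d = 0 and `down` is strict, in agreement with the sign test
-- of `∂term`.
data Gap : ℕ → ℕ → Set where
  up   : ∀ lo d → Gap lo (lo + d)
  down : ∀ lo d → Gap (lo + suc d) lo

gap : ∀ p q → Gap p q
gap p q with ℕ.≤-<-connex p q
... | inj₁ p≤q = subst (Gap p) (ℕ.m+[n∸m]≡n p≤q) (up p (q ∸ p))
... | inj₂ q<p = subst (λ p → Gap p q) (trans (ℕ.+-suc q (p ∸ suc q)) (ℕ.m+[n∸m]≡n q<p)) (down q (p ∸ suc q))

∂term-up : ∀ i c a lo d → get a i ≡ lo → get a (suc i) ≡ lo + d → ∂term i (c , a) ≡ run i (-ℤ c) a lo d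
∂term-up i c a lo d eˡ eʳ
  rewrite eˡ | eʳ | dec-true (lo ≤? lo + d) (ℕ.m≤m+n lo d)
        | dec-false (lo + d <? lo) (ℕ.≤⇒≯ (ℕ.m≤m+n lo d))
        | ℕ.m≤n⇒m∸n≡0 (ℕ.m≤m+n lo d) | ℕ.m+n∸m≡n lo d = refl

∂term-down : ∀ i c a lo d → get a i ≡ lo + suc d → get a (suc i) ≡ lo → ∂term i (c , a) ≡ run i c a lo (suc d)
∂term-down i c a lo d eˡ eʳ
  rewrite eˡ | eʳ | dec-false (lo + suc d ≤? lo) (ℕ.m+1+n≰m lo)
        | dec-true (lo <? lo + suc d) (ℕ.m<m+n lo z<s)
        | ℕ.m+n∸m≡n lo (suc d) | ℕ.m≤n⇒m∸n≡0 (ℕ.m≤m+n lo (suc d)) | ℕ.+-identityʳ d = refl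

Bounded : ℕ → List ℕ → Set
Bounded m a = ∀ k → get a k ≤ m

Bounded-put : ∀ {m} i a {x y} → Bounded m a → x ≤ m → y ≤ m → Bounded m (put i a x y)
Bounded-put {m} i a {x} {y} a≤m x≤m y≤m k with i ℕ.≟ k | suc i ℕ.≟ k
... | yes refl | _        = subst (_≤ m) (sym (get-putˡ i a x y)) x≤m
... | no _     | yes refl = subst (_≤ m) (sym (get-putʳ i a x y)) y≤m
... | no i≢k   | no 1+i≢k = subst (_≤ m) (sym (get-put-≢ i a x y i≢k 1+i≢k)) (a≤m k)

raise : ℕ → Poly → Poly
raise i = map (mulXX i)

raise-run : ∀ i c a lo d → raise i (run i c a lo d) ≡
  map (λ k → c , put i a (suc (lo + k)) (suc (lo + (d ∸ 1 ∸ k)))) (upTo d)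
raise-run i c a lo d = trans (sym (map-∘ (upTo d)))
  (map-cong (λ k → cong (c ,_) (shape (lo + k) (lo + (d ∸ 1 ∸ k)))) (upTo d))
  where
  shape : ∀ u v → put i (put i a u v) (suc (get (put i a u v) i)) (suc (get (put i a u v) (suc i))) ≡ put i a (suc u) (suc v)
  shape u v rewrite get-putˡ i a u v | get-putʳ i a u v = put-put i a u v (suc u) (suc v)

get-map-applyUpTo-< : ∀ (f : ℕ → ℕ) h {n k} → k < n → get (map f (applyUpTo h n)) k ≡ f (h k)
get-map-applyUpTo-< f h {suc n} {zero}  k<n = refl
get-map-applyUpTo-< f h {suc n} {suc k} k<n = get-map-applyUpTo-< f (h ∘ suc) (s<s⁻¹ k<n)

get-map-applyUpTo-≥ : ∀ (f : ℕ → ℕ) h {n k} → n ≤ k → get (map f (applyUpTo h n)) k ≡ 0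
get-map-applyUpTo-≥ f h {zero}          n≤k = refl
get-map-applyUpTo-≥ f h {suc n} {suc k} n≤k = get-map-applyUpTo-≥ f (h ∘ suc) (s≤s⁻¹ n≤k)

-- Indices are 0-based: the 1-based positions i + 1 and j + 1 add up to n, and the reflection
-- carries the pair i, i + 1 to j + 1, j.
module Mirror (m n i j : ℕ) (mirror : suc (suc (i + j)) ≡ n) where

  j<n : j < n
  j<n = subst (j <_) mirror (s≤s (ℕ.≤-trans (ℕ.m≤n+m j i) (ℕ.n≤1+n _)))

  1+j<n : suc j < n
  1+j<n = subst (suc j <_) mirror (s≤s (s≤s (ℕ.m≤n+m j i)))

  mirror-j : n ∸ 1 ∸ j ≡ suc i
  mirror-j rewrite sym mirror = ℕ.m+n∸n≡m (suc i) j

  mirror-1+j : n ∸ 1 ∸ suc j ≡ i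
  mirror-1+j rewrite sym mirror = ℕ.m+n∸n≡m i j

  get-rExpˡ : ∀ a → get (rExp m n a) j ≡ m ∸ get a (suc i)
  get-rExpˡ a = trans (get-map-applyUpTo-< _ id j<n) (cong (λ k → m ∸ get a k) mirror-j)

  get-rExpʳ : ∀ a → get (rExp m n a) (suc j) ≡ m ∸ get a i
  get-rExpʳ a = trans (get-map-applyUpTo-< _ id 1+j<n) (cong (λ k → m ∸ get a k) mirror-1+j)

  rExp-put : ∀ a x y → rExp m n (put i a x y) ≐ put j (rExp m n a) (m ∸ y) (m ∸ x)
  rExp-put a x y = ≐-by-cases j (rExp m n (put i a x y)) (put j (rExp m n a) (m ∸ y) (m ∸ x))
    (trans (get-rExpˡ (put i a x y)) (trans (cong (m ∸_) (get-putʳ i a x y)) (sym (get-putˡ j (rExp m n a) _ _))))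
    (trans (get-rExpʳ (put i a x y)) (trans (cong (m ∸_) (get-putˡ i a x y)) (sym (get-putʳ j (rExp m n a) (m ∸ y) _))))
    (λ k j≢k 1+j≢k → trans (elsewhere k j≢k 1+j≢k) (sym (get-put-≢ j (rExp m n a) _ _ j≢k 1+j≢k)))
    where
    elsewhere : ∀ k → j ≢ k → suc j ≢ k → get (rExp m n (put i a x y)) k ≡ get (rExp m n a) k
    elsewhere k j≢k 1+j≢k with ℕ.<-≤-connex k n
    ... | inj₂ n≤k = trans (get-map-applyUpTo-≥ _ id n≤k) (sym (get-map-applyUpTo-≥ _ id n≤k))
    ... | inj₁ k<n = trans (get-map-applyUpTo-< _ id k<n) (trans
      (cong (m ∸_) (get-put-≢ i a x y
        (λ e → 1+j≢k (injective 1+j<n k<n (trans mirror-1+j e)))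
        (λ e → j≢k (injective j<n k<n (trans mirror-j e)))))
      (sym (get-map-applyUpTo-< _ id k<n)))
      where
      injective : ∀ {k l} → k < n → l < n → n ∸ 1 ∸ k ≡ n ∸ 1 ∸ l → k ≡ l
      injective k<n l<n = ℕ.∸-cancelˡ-≡ (ℕ.∸-monoˡ-≤ 1 k<n) (ℕ.∸-monoˡ-≤ 1 l<n)

  -- Reflection both complements and exchanges the two exponents, so the k-th term goes to the k-th
  -- term: the second exponent lo + d - k becomes m - lo - d + k = e + k. Here e is the smaller
  -- reflected exponent.
  rPoly-raise-run : ∀ c a lo d e → lo + d + e ≡ m →
    Pointwise _≃T_ (rPoly m n (raise i (run i c a lo d))) (run j c (rExp m n a) e d)
  rPoly-raise-run c a lo d e total
    rewrite raise-run i c a lo d =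
    pointwise id d (λ k<d → k<d)
    where
    exponents : ∀ {k} → k < d → rExp m n (put i a (suc (lo + k)) (suc (lo + (d ∸ 1 ∸ k)))) ≐
      put j (rExp m n a) (e + k) (e + (d ∸ 1 ∸ k))
    exponents {k} k<d l = trans (rExp-put a (suc (lo + k)) (suc (lo + (d ∸ 1 ∸ k))) l)
      (cong₂ (λ x y → get (put j (rExp m n a) x y) l)
        (complement (d ∸ 1 ∸ k) k (ℕ.+-comm (d ∸ 1 ∸ k) k))
        (complement k (d ∸ 1 ∸ k) refl))
      where
      split : suc (k + (d ∸ 1 ∸ k)) ≡ d
      split = trans (cong (suc k +_) (ℕ.∸-+-assoc d 1 k)) (ℕ.m+[n∸m]≡n k<d)
      lem : ∀ lo e s t → lo + suc (s + t) + e ≡ suc (lo + s) + (e + t)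
      lem = solve-∀
      complement : ∀ s t → s + t ≡ k + (d ∸ 1 ∸ k) → m ∸ suc (lo + s) ≡ e + t
      complement s t s+t = trans (cong (_∸ suc (lo + s)) (begin
        m                            ≡⟨ total ⟨
        lo + d + e                   ≡⟨ cong (λ d → lo + d + e) (trans (cong suc s+t) split) ⟨
        lo + suc (s + t) + e         ≡⟨ lem lo e s t ⟩
        suc (lo + s) + (e + t)       ∎)) (ℕ.m+n∸m≡n (suc (lo + s)) (e + t))
        where open ≡-Reasoning
    -- A general index function h is carried along because the tail of `applyUpTo` shifts it.
    pointwise : ∀ h l → (∀ {k} → k < l → h k < d) → Pointwise _≃T_
      (rPoly m n (map (λ k → c , put i a (suc (lo + k)) (suc (lo + (d ∸ 1 ∸ k)))) (applyUpTo h l)))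
      (map (λ k → c , put j (rExp m n a) (e + k) (e + (d ∸ 1 ∸ k))) (applyUpTo h l))
    pointwise h zero    h<d = []
    pointwise h (suc l) h<d = (refl , exponents (h<d z<s)) ∷ pointwise (h ∘ suc) l (h<d ∘ s<s)

  rPoly-raise-∂term : ∀ c a → Bounded m a →
    Pointwise _≃T_ (rPoly m n (raise i (∂term i (c , a)))) (∂term j (c , rExp m n a))
  rPoly-raise-∂term c a a≤m = by-gap (gap (get a i) (get a (suc i))) refl refl
    where
    by-gap : ∀ {p q} → Gap p q → get a i ≡ p → get a (suc i) ≡ q →
      Pointwise _≃T_ (rPoly m n (raise i (∂term i (c , a)))) (∂term j (c , rExp m n a))
    by-gap (up lo d) eˡ eʳ = subst₂ (λ f g → Pointwise _≃T_ (rPoly m n (raise i f)) g)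
      (sym (∂term-up i c a lo d eˡ eʳ))
      (sym (∂term-up j c (rExp m n a) e d
        (trans (get-rExpˡ a) (cong (m ∸_) eʳ))
        (trans (get-rExpʳ a) (trans (cong (m ∸_) eˡ) m∸lo))))
      (rPoly-raise-run (-ℤ c) a lo d e total)
      where
      e = m ∸ (lo + d)
      total : lo + d + e ≡ m
      total = ℕ.m+[n∸m]≡n (subst (_≤ m) eʳ (a≤m (suc i)))
      m∸lo : m ∸ lo ≡ e + d
      m∸lo = trans (cong (_∸ lo) (trans (sym total)
        (trans (ℕ.+-assoc lo d e) (cong (lo +_) (ℕ.+-comm d e))))) (ℕ.m+n∸m≡n lo (e + d))
    by-gap (down lo d) eˡ eʳ = subst₂ (λ f g → Pointwise _≃T_ (rPoly m n (raise i f)) g)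
      (sym (∂term-down i c a lo d eˡ eʳ))
      (sym (∂term-down j c (rExp m n a) e d
        (trans (get-rExpˡ a) (trans (cong (m ∸_) eʳ) m∸lo))
        (trans (get-rExpʳ a) (cong (m ∸_) eˡ))))
      (rPoly-raise-run c a lo (suc d) e total)
      where
      e = m ∸ (lo + suc d)
      total : lo + suc d + e ≡ m
      total = ℕ.m+[n∸m]≡n (subst (_≤ m) eˡ (a≤m i))
      m∸lo : m ∸ lo ≡ e + suc d
      m∸lo = trans (cong (_∸ lo) (trans (sym total)
        (trans (ℕ.+-assoc lo (suc d) e) (cong (lo +_) (ℕ.+-comm (suc d) e))))) (ℕ.m+n∸m≡n lo (e + suc d))

  rPoly-π̂-pointwise : ∀ f → All (Bounded m ∘ proj₂) f →
    Pointwise _≃T_ (rPoly m n (π̂ i f)) (∂ j (rPoly m n f))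
  rPoly-π̂-pointwise []            []          = []
  rPoly-π̂-pointwise ((c , a) ∷ f) (a≤m ∷ f≤m)
    rewrite map-++ (mulXX i) (∂term i (c , a)) (∂ i f) =
    subst (λ g → Pointwise _≃T_ g (∂ j (rPoly m n ((c , a) ∷ f))))
      (sym (map-++ _ (raise i (∂term i (c , a))) (π̂ i f)))
      (Pointwise.++⁺ (rPoly-raise-∂term c a a≤m) (rPoly-π̂-pointwise f f≤m))

  rPoly-π̂ : ∀ f → All (Bounded m ∘ proj₂) f → rPoly m n (π̂ i f) ≋ ∂ j (rPoly m n f)
  rPoly-π̂ f f≤m = pointwise⇒≋ (rPoly-π̂-pointwise f f≤m)

-- In the geometric sum no exponent exceeds lo + d - 1, so raising by one stays within the old
-- maximum lo + d. The bound is what keeps the truncated subtraction in `rExp` a true complement.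
π̂-bounded : ∀ m i f → All (Bounded m ∘ proj₂) f → All (Bounded m ∘ proj₂) (π̂ i f)
π̂-bounded m i []            []          = []
π̂-bounded m i ((c , a) ∷ f) (a≤m ∷ f≤m)
  rewrite map-++ (mulXX i) (∂term i (c , a)) (∂ i f) =
  All.++⁺ (by-gap (gap (get a i) (get a (suc i))) refl refl) (π̂-bounded m i f f≤m)
  where
  run-bounded : ∀ c lo d → lo + d ≤ m → All (Bounded m ∘ proj₂) (raise i (run i c a lo d))
  run-bounded c lo d lo+d≤m rewrite raise-run i c a lo d =
    All.map⁺ (All.applyUpTo⁺₁ id d λ {k} k<d → Bounded-put i a a≤m
      (bound k<d)
      (bound (ℕ.≤-<-trans (ℕ.m∸n≤m (d ∸ 1) k) (ℕ.∸-monoʳ-< z<s (ℕ.≤-trans z<s k<d)))))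
    where
    bound : ∀ {k} → k < d → suc (lo + k) ≤ m
    bound {k} k<d = ℕ.≤-trans (ℕ.≤-reflexive (sym (ℕ.+-suc lo k))) (ℕ.≤-trans (ℕ.+-monoʳ-≤ lo k<d) lo+d≤m)
  by-gap : ∀ {p q} → Gap p q → get a i ≡ p → get a (suc i) ≡ q →
    All (Bounded m ∘ proj₂) (raise i (∂term i (c , a)))
  by-gap (up lo d)   eˡ eʳ rewrite ∂term-up i c a lo d eˡ eʳ =
    run-bounded (-ℤ c) lo d (subst (_≤ m) eʳ (a≤m (suc i)))
  by-gap (down lo d) eˡ eʳ rewrite ∂term-down i c a lo d eˡ eʳ =
    run-bounded c lo (suc d) (subst (_≤ m) eˡ (a≤m i))

hatLfuel-bounded : ∀ m f a → Bounded m a → All (Bounded m ∘ proj₂) (hatLfuel f a)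
hatLfuel-bounded m zero    a a≤m = []
hatLfuel-bounded m (suc f) a a≤m with isPartition a | firstAscent a
... | true  | _       = a≤m ∷ []
... | false | nothing = []
... | false | just i  = π̂-bounded m i (hatLfuel f (swapAt i a))
  (hatLfuel-bounded m f (swapAt i a) (Bounded-put i a a≤m (a≤m (suc i)) (a≤m i)))

-- Standardization

ascent-at : ∀ P {x y Q} → x < y → Ascent (length P) (P ++ x ∷ y ∷ Q)
ascent-at []      x<y = here x<y
ascent-at (_ ∷ P) x<y = there (ascent-at P x<y)

swapAt-at : ∀ P {x y Q} → swapAt (length P) (P ++ x ∷ y ∷ Q) ≡ P ++ y ∷ x ∷ Q
swapAt-at []      = refl
swapAt-at (p ∷ P) = cong (p ∷_) (swapAt-at P)

record AscentSplit (i : ℕ) (w : List ℕ) : Set where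
  constructor split
  field
    {prefix suffix} : List ℕ
    {lower upper}   : ℕ
    lower<upper     : lower < upper
    length-prefix   : length prefix ≡ i
    w≡              : w ≡ prefix ++ lower ∷ upper ∷ suffix

ascentSplit : ∀ {i w} → Ascent i w → AscentSplit i w
ascentSplit (here x<y) = split {prefix = []} x<y refl refl
ascentSplit (there {x = x} p) with ascentSplit p
... | split {prefix = P} x<y refl refl = split {prefix = x ∷ P} x<y refl refl

restrictions : ℕ → ℕ → List ℕ → List ℕ
restrictions m n a = stdHead m 0 (rExp (suc m) n a)

missing : List ℕ → ℕ → List ℕ
missing hd N = filter (λ v → T? (not (memb v hd))) (map suc (upTo N))

-- std m n α is stdList m n (toList α) by definition.
stdList : ℕ → ℕ → List ℕ → List ℕ
stdList m n a = restrictions m n a ++ missing (restrictions m n a) (n + m)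

applyUpTo-get : ∀ a → applyUpTo (get a) (length a) ≡ a
applyUpTo-get []      = refl
applyUpTo-get (x ∷ a) = cong (x ∷_) (applyUpTo-get a)

applyUpTo-reflect : ∀ (h : ℕ → ℕ) n → applyUpTo (λ k → h (n ∸ 1 ∸ k)) n ≡ applyDownFrom h n
applyUpTo-reflect h zero          = refl
applyUpTo-reflect h (suc zero)    = refl
applyUpTo-reflect h (suc (suc n)) = cong (h (suc n) ∷_) (applyUpTo-reflect h (suc n))

rExp-reverse : ∀ m a → rExp m (length a) a ≡ map (m ∸_) (reverse a)
rExp-reverse m a = begin
  map (λ k → m ∸ get a (n ∸ 1 ∸ k)) (upTo n)      ≡⟨ map-upTo _ n ⟩
  applyUpTo (λ k → m ∸ get a (n ∸ 1 ∸ k)) n       ≡⟨ applyUpTo-reflect (λ k → m ∸ get a k) n ⟩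
  applyDownFrom (λ k → m ∸ get a k) n             ≡⟨ reverse-applyUpTo (λ k → m ∸ get a k) n ⟨
  reverse (applyUpTo (λ k → m ∸ get a k) n)       ≡⟨ cong reverse (map-applyUpTo (get a) (m ∸_) n) ⟨
  reverse (map (m ∸_) (applyUpTo (get a) n))      ≡⟨ cong (reverse ∘ map (m ∸_)) (applyUpTo-get a) ⟩
  reverse (map (m ∸_) a)                          ≡⟨ reverse-map (m ∸_) a ⟨
  map (m ∸_) (reverse a)                          ∎
  where
  open ≡-Reasoning
  n = length a

map-reverse-split : ∀ (f : ℕ → ℕ) P x y Q →
  map f (reverse (P ++ x ∷ y ∷ Q)) ≡ map f (reverse Q) ++ f y ∷ f x ∷ map f (reverse P)
map-reverse-split f P x y Q = begin
  map f (reverse (P ++ x ∷ y ∷ Q))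
    ≡⟨ cong (map f) (trans (reverse-++ P (x ∷ y ∷ Q)) (cong (_++ reverse P) (reverse-++ (x ∷ y ∷ []) Q))) ⟩
  map f ((reverse Q ++ y ∷ x ∷ []) ++ reverse P)
    ≡⟨ cong (map f) (++-assoc (reverse Q) (y ∷ x ∷ []) (reverse P)) ⟩
  map f (reverse Q ++ y ∷ x ∷ reverse P)
    ≡⟨ map-++ f (reverse Q) (y ∷ x ∷ reverse P) ⟩
  map f (reverse Q) ++ f y ∷ f x ∷ map f (reverse P) ∎
  where open ≡-Reasoning

-- The counter reached after P is independent of what follows, so one c′ serves both orders of the
-- next two entries.
stdHead-++ : ∀ m c P → ∃ λ c′ → ∀ Q → stdHead m c (P ++ Q) ≡ stdHead m c P ++ stdHead m c′ Q
stdHead-++ m c []      = c , λ Q → refl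
stdHead-++ m c (b ∷ P) with b ≤ᵇ m
... | true  = let c′ , e = stdHead-++ m c P in c′ , λ Q → cong (b ∷_) (e Q)
... | false = let c′ , e = stdHead-++ m (suc c) P in c′ , λ Q → cong (m + suc c ∷_) (e Q)

length-stdHead : ∀ m c P → length (stdHead m c P) ≡ length P
length-stdHead m c []      = refl
length-stdHead m c (b ∷ P) with b ≤ᵇ m
... | true  = cong suc (length-stdHead m c P)
... | false = cong suc (length-stdHead m (suc c) P)

-- An entry b ≤ m does not advance the counter, so its neighbour receives the same value v on either
-- side of it, also when b′ is replaced.
stdHead-swap : ∀ m c b b′ Q → b ≤ m → b < b′ →
  ∃₂ λ v R → b < v × stdHead m c (b ∷ b′ ∷ Q) ≡ b ∷ v ∷ R × stdHead m c (b′ ∷ b ∷ Q) ≡ v ∷ b ∷ R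
stdHead-swap m c b b′ Q b≤m b<b′ with ℕ.≤-<-connex b′ m
... | inj₁ b′≤m rewrite dec-true (b ≤? m) b≤m | dec-true (b′ ≤? m) b′≤m = b′ , stdHead m c Q , b<b′ , refl , refl
... | inj₂ m<b′ rewrite dec-true (b ≤? m) b≤m | dec-false (b′ ≤? m) (ℕ.<⇒≱ m<b′) =
  m + suc c , stdHead m (suc c) Q , ℕ.≤-<-trans b≤m (ℕ.m<m+n m z<s) , refl , refl

memb⇒∈ : ∀ v xs → T (memb v xs) → v ∈ xs
memb⇒∈ v (x ∷ xs) t with Equivalence.to T-∨ t
... | inj₁ v≡x  = here (ℕ.≡ᵇ⇒≡ v x v≡x)
... | inj₂ v∈xs = there (memb⇒∈ v xs v∈xs)

∈⇒memb : ∀ v xs → v ∈ xs → T (memb v xs)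
∈⇒memb v (x ∷ xs) (here v≡x)   = Equivalence.from T-∨ (inj₁ (ℕ.≡⇒≡ᵇ v x v≡x))
∈⇒memb v (x ∷ xs) (there v∈xs) = Equivalence.from T-∨ (inj₂ (∈⇒memb v xs v∈xs))

memb-↭ : ∀ v {xs ys} → xs ↭ ys → memb v xs ≡ memb v ys
memb-↭ v {xs} {ys} p = ⇔→≡ (mk⇔ (transport p) (transport (↭-sym p)))
  where
  transport : ∀ {xs ys} → xs ↭ ys → memb v xs ≡ true → memb v ys ≡ true
  transport p = Equivalence.to T-≡ ∘ ∈⇒memb v _ ∘ ∈-resp-↭ p ∘ memb⇒∈ v _ ∘ Equivalence.from T-≡

-- The tail depends on the head only as a set of values, so a swap inside the head leaves it
-- unchanged.
missing-↭ : ∀ {xs ys} N → xs ↭ ys → missing xs N ≡ missing ys N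
missing-↭ N p = filter-≐ _ _
  ((λ {v} → subst (T ∘ not) (memb-↭ v p)) , (λ {v} → subst (T ∘ not) (sym (memb-↭ v p))))
  (map suc (upTo N))

ascent-++ : ∀ {i w} → Ascent i w → ∀ v → Ascent i (w ++ v)
ascent-++ (here x<y) v = here x<y
ascent-++ (there p)  v = there (ascent-++ p v)

swapAt-++ : ∀ {i w} → Ascent i w → ∀ v → swapAt i (w ++ v) ≡ swapAt i w ++ v
swapAt-++ (here x<y)        v = refl
swapAt-++ (there {x = x} p) v = cong (x ∷_) (swapAt-++ p v)

restrictions≡ : ∀ m {n} a → length a ≡ n → restrictions m n a ≡ stdHead m 0 (map (suc m ∸_) (reverse a))
restrictions≡ m a refl = cong (stdHead m 0) (rExp-reverse (suc m) a)

record StdAscent (m n i : ℕ) (a : List ℕ) : Set where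
  field
    position : ℕ
    mirrored : suc (suc (i + position)) ≡ n
    ascent   : Ascent position (stdList m n a)
    std-swap : stdList m n (swapAt i a) ≡ swapAt position (stdList m n a)

stdAscent : ∀ {m n i a} → length a ≡ n → All (_≤ m) a → Ascent i a → StdAscent m n i a
stdAscent {m} {n} |a|≡n a≤m p with ascentSplit p
... | split {P} {Q} {x} {y} x<y refl refl
    -- At an ascent x < y of α the upper entry is positive, so its complement m + 1 - y is at most
    -- m: of the two reflected entries at most one is m + 1.
    with stdHead-++ m 0 (map (suc m ∸_) (reverse Q))
       | stdHead-swap m (proj₁ (stdHead-++ m 0 (map (suc m ∸_) (reverse Q)))) (suc m ∸ y) (suc m ∸ x)
           (map (suc m ∸_) (reverse P)) (ℕ.∸-monoʳ-≤ (suc m) (ℕ.≤-trans z<s x<y))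
           (ℕ.∸-monoʳ-< x<y (ℕ.m≤n⇒m≤1+n (All.head (All.tail (All.++⁻ʳ P a≤m)))))
... | c , stdHead≡ | v , R , b<v , ordered , swapped = record
  { position = length H
  ; mirrored = mirrored
  ; ascent   = subst (Ascent (length H)) (sym std≡) (ascent-++ head-ascent tl)
  ; std-swap = std-swap
  }
  where
  a a′ H tl : List ℕ
  a  = P ++ x ∷ y ∷ Q
  a′ = P ++ y ∷ x ∷ Q
  H  = stdHead m 0 (map (suc m ∸_) (reverse Q))
  tl = missing (H ++ suc m ∸ y ∷ v ∷ R) (n + m)

  length-swap : length a′ ≡ n
  length-swap = trans (length-++ P) (trans (sym (length-++ P)) |a|≡n)

  mirrored : suc (suc (length P + length H)) ≡ n
  mirrored = begin
    suc (suc (length P + length H))  ≡⟨ cong (λ l → suc (suc (length P + l))) (trans (length-stdHead m 0 (map (suc m ∸_) (reverse Q)))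
                                          (trans (length-map (suc m ∸_) (reverse Q)) (length-reverse Q))) ⟩
    suc (suc (length P + length Q))  ≡⟨ trans (cong suc (sym (ℕ.+-suc (length P) (length Q)))) (sym (ℕ.+-suc (length P) (suc (length Q)))) ⟩
    length P + length (x ∷ y ∷ Q)    ≡⟨ length-++ P ⟨
    length a                         ≡⟨ |a|≡n ⟩
    n                                ∎
    where open ≡-Reasoning

  head-ascent : Ascent (length H) (H ++ suc m ∸ y ∷ v ∷ R)
  head-ascent = ascent-at H b<v

  head≡ : restrictions m n a ≡ H ++ suc m ∸ y ∷ v ∷ R
  head≡ = trans (restrictions≡ m a |a|≡n) (trans (cong (stdHead m 0) (map-reverse-split (suc m ∸_) P x y Q))
    (trans (stdHead≡ _) (cong (H ++_) ordered)))

  head′≡ : restrictions m n a′ ≡ swapAt (length H) (H ++ suc m ∸ y ∷ v ∷ R)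
  head′≡ = trans (restrictions≡ m a′ length-swap) (trans (cong (stdHead m 0) (map-reverse-split (suc m ∸_) P y x Q))
    (trans (stdHead≡ _) (trans (cong (H ++_) swapped) (sym (swapAt-at H)))))

  std≡ : stdList m n a ≡ (H ++ suc m ∸ y ∷ v ∷ R) ++ tl
  std≡ = cong (λ hd → hd ++ missing hd (n + m)) head≡

  std-swap : stdList m n (swapAt (length P) a) ≡ swapAt (length H) (stdList m n a)
  std-swap = begin
    stdList m n (swapAt (length P) a)
      ≡⟨ cong (stdList m n) (swapAt-at P) ⟩
    stdList m n a′
      ≡⟨ cong (λ hd → hd ++ missing hd (n + m)) head′≡ ⟩
    swapAt (length H) (H ++ suc m ∸ y ∷ v ∷ R) ++ missing (swapAt (length H) (H ++ suc m ∸ y ∷ v ∷ R)) (n + m)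
      ≡⟨ cong (swapAt (length H) (H ++ suc m ∸ y ∷ v ∷ R) ++_) (missing-↭ (n + m) (swapAt-↭ head-ascent)) ⟩
    swapAt (length H) (H ++ suc m ∸ y ∷ v ∷ R) ++ tl
      ≡⟨ swapAt-++ head-ascent tl ⟨
    swapAt (length H) ((H ++ suc m ∸ y ∷ v ∷ R) ++ tl)
      ≡⟨ cong (swapAt (length H)) std≡ ⟨
    swapAt (length H) (stdList m n a) ∎
    where open ≡-Reasoning

-- Snowiness for lists: only zero may repeat. Under x ↦ m + 1 - x zeros become m + 1, which leads to
-- `RepeatsExceed`.
NoPositiveRepeat : List ℕ → Set
NoPositiveRepeat = AllPairs (λ x y → x ≡ y → x ≡ 0)

RepeatsExceed : ℕ → List ℕ → Set
RepeatsExceed m = AllPairs (λ b b′ → b ≡ b′ → m < b)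

∈-stdHead : ∀ {m c v} bs → v ∈ stdHead m c bs → (v ≤ m × v ∈ bs) ⊎ m + c < v
∈-stdHead {m} {c} (b ∷ bs) v∈ with b ≤? m
... | yes b≤m rewrite dec-true (b ≤? m) b≤m with v∈
...   | here refl = inj₁ (b≤m , here refl)
...   | there v∈′ with ∈-stdHead bs v∈′
...     | inj₁ (v≤m , v∈bs) = inj₁ (v≤m , there v∈bs)
...     | inj₂ m+c<v        = inj₂ m+c<v
∈-stdHead {m} {c} (b ∷ bs) v∈ | no b≰m rewrite dec-false (b ≤? m) b≰m with v∈
...   | here refl = inj₂ (ℕ.+-monoʳ-< m (ℕ.n<1+n c))
...   | there v∈′ with ∈-stdHead bs v∈′
...     | inj₁ (v≤m , v∈bs) = inj₁ (v≤m , there v∈bs)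
...     | inj₂ m+1+c<v      = inj₂ (ℕ.<-trans (ℕ.+-monoʳ-< m (ℕ.n<1+n c)) m+1+c<v)

-- Entries at most m are kept and do not repeat; every other entry is replaced by a value above m
-- that grows with the counter.
stdHead-unique : ∀ {m c bs} → RepeatsExceed m bs → Unique (stdHead m c bs)
stdHead-unique []                                  = []
stdHead-unique {m} {c} {b ∷ bs} (b-fresh ∷ bs-ok) with b ≤? m
... | yes b≤m rewrite dec-true (b ≤? m) b≤m = All.tabulate fresh ∷ stdHead-unique bs-ok
  where
  fresh : ∀ {v} → v ∈ stdHead m c bs → b ≢ v
  fresh v∈ refl with ∈-stdHead bs v∈
  ... | inj₁ (_ , b∈bs) = ℕ.<⇒≱ (All.lookup b-fresh b∈bs refl) b≤m
  ... | inj₂ m+c<b      = ℕ.<⇒≱ (ℕ.≤-<-trans (ℕ.m≤m+n m c) m+c<b) b≤m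
... | no b≰m rewrite dec-false (b ≤? m) b≰m = All.tabulate fresh ∷ stdHead-unique bs-ok
  where
  fresh : ∀ {v} → v ∈ stdHead m (suc c) bs → m + suc c ≢ v
  fresh v∈ refl with ∈-stdHead bs v∈
  ... | inj₁ (m+1+c≤m , _) = ℕ.m+1+n≰m m m+1+c≤m
  ... | inj₂ lt            = ℕ.<-irrefl refl lt

T-not : ∀ {b} → T (not b) → ¬ T b
T-not {false} _ ()

not-T : ∀ {b} → ¬ T b → T (not b)
not-T {false} _  = _
not-T {true}  ¬t = ¬t _

++-missing-unique : ∀ {hd} N → Unique hd → Unique (hd ++ missing hd N)
++-missing-unique {hd} N u = Unique.++⁺ u
  (Unique.filter⁺ _ (Unique.map⁺ ℕ.suc-injective (Unique.upTo⁺ N)))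
  (λ {v} (v∈hd , v∈missing) → T-not (proj₂ (∈-filter⁻ _ {xs = map suc (upTo N)} v∈missing)) (∈⇒memb v hd v∈hd))

∈-++-missing : ∀ {v} hd N → 1 ≤ v → v ≤ N → v ∈ hd ++ missing hd N
∈-++-missing {suc v} hd N _ v<N with T? (memb (suc v) hd)
... | yes t = ∈-++⁺ˡ (memb⇒∈ (suc v) hd t)
... | no ¬t = ∈-++⁺ʳ hd (∈-filter⁺ _ (∈-map⁺ suc (∈-upTo⁺ v<N)) (not-T ¬t))

missing-ascending : ∀ hd N → AllPairs _<_ (missing hd N)
missing-ascending hd N = AllPairs.filter⁺ _
  (AllPairs.map⁺ (AllPairs.applyUpTo⁺₁ id N (λ i<j _ → s<s i<j)))

missing-positive : ∀ hd N → All (1 ≤_) (missing hd N)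
missing-positive hd N = All.filter⁺ _ (All.map⁺ (All.applyUpTo⁺₂ id N (λ _ → z<s)))

AllPairs-reverse : ∀ {ℓ} {R : Rel ℕ ℓ} {xs} → AllPairs R xs → AllPairs (flip R) (reverse xs)
AllPairs-reverse []                   = []
AllPairs-reverse {R = R} {x ∷ xs} (rx ∷ rxs) rewrite unfold-reverse x xs =
  AllPairs.++⁺ (AllPairs-reverse rxs) ([] ∷ [])
    (All.map (_∷ []) (All-resp-↭ (↭-sym (↭-reverse xs)) rx))

AllPairs-with : ∀ {p ℓ} {P : ℕ → Set p} {R : Rel ℕ ℓ} {xs} → All P xs → AllPairs R xs →
  AllPairs (λ x y → P x × P y × R x y) xs
AllPairs-with []         []         = []
AllPairs-with (px ∷ pxs) (rx ∷ rxs) =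
  All.zipWith (λ (py , r) → px , py , r) (pxs , rx) ∷ AllPairs-with pxs rxs

complement-repeats : ∀ {m a} → All (_≤ m) a → NoPositiveRepeat a →
  RepeatsExceed m (map (suc m ∸_) (reverse a))
complement-repeats {m} a≤m a-ok =
  AllPairs.map⁺ (AllPairs.map exceed (AllPairs-reverse (AllPairs-with a≤m a-ok)))
  where
  exceed : ∀ {x y} → y ≤ m × x ≤ m × (y ≡ x → y ≡ 0) → suc m ∸ x ≡ suc m ∸ y → m < suc m ∸ x
  exceed (y≤m , x≤m , zero-repeat) e
    with ℕ.∸-cancelˡ-≡ (ℕ.m≤n⇒m≤1+n x≤m) (ℕ.m≤n⇒m≤1+n y≤m) e
  ... | refl rewrite zero-repeat refl = ℕ.≤-refl

stdList-unique : ∀ {m n a} → length a ≡ n → All (_≤ m) a → NoPositiveRepeat a → Unique (stdList m n a)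
stdList-unique {m} {n} {a} |a|≡n a≤m a-ok = ++-missing-unique (n + m)
  (subst Unique (sym (restrictions≡ m a |a|≡n)) (stdHead-unique (complement-repeats a≤m a-ok)))

-- The code of a standardized partition

isPartition⇒AllPairs : ∀ xs → isPartition xs ≡ true → AllPairs (λ x y → y ≤ x) xs
isPartition⇒AllPairs []       e = []
isPartition⇒AllPairs (x ∷ xs) e = head-bounds xs e ∷ isPartition⇒AllPairs xs (isPartition-tail x xs e)
  where
  head-bounds : ∀ {x} xs → isPartition (x ∷ xs) ≡ true → All (_≤ x) xs
  head-bounds []           e = []
  head-bounds {x} (y ∷ ys) e with isPartition-uncons x y ys e
  ... | y≤x , e′ = y≤x ∷ All.map (λ z≤y → ℕ.≤-trans z≤y y≤x) (head-bounds ys e′)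

AllPairs⇒isPartition : ∀ {xs} → AllPairs (λ x y → y ≤ x) xs → isPartition xs ≡ true
AllPairs⇒isPartition []                             = refl
AllPairs⇒isPartition {x ∷ []}     (_ ∷ _)           = refl
AllPairs⇒isPartition {x ∷ y ∷ ys} ((y≤x ∷ _) ∷ rest) = isPartition-∷ x y ys y≤x (AllPairs⇒isPartition rest)

-- The entries below x and the list 1, ..., k are both free of repetitions and have the same
-- members, so they are permutations of each other.
countLess-interval : ∀ {x k xs} → Unique xs →
  (∀ {v} → v ∈ xs → v < x → 1 ≤ v × v ≤ k) →
  (∀ {v} → 1 ≤ v → v ≤ k → v ∈ xs × v < x) →
  countLess x xs ≡ k
countLess-interval {x} {k} {xs} u sound complete = begin
  length (filter (_<? x) xs)   ≡⟨ ↭-length (∼bag⇒↭ (unique∧set⇒bag (Unique.filter⁺ (_<? x) u)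
                                    (Unique.map⁺ ℕ.suc-injective (Unique.upTo⁺ k)) (mk⇔ to from))) ⟩
  length (map suc (upTo k))    ≡⟨ trans (length-map suc (upTo k)) (length-upTo k) ⟩
  k                            ∎
  where
  open ≡-Reasoning
  to : ∀ {v} → v ∈ filter (_<? x) xs → v ∈ map suc (upTo k)
  to v∈ with ∈-filter⁻ (_<? x) {xs = xs} v∈
  ... | v∈xs , v<x with sound v∈xs v<x
  ...   | s≤s _ , v≤k = ∈-map⁺ suc (∈-upTo⁺ v≤k)
  from : ∀ {v} → v ∈ map suc (upTo k) → v ∈ filter (_<? x) xs
  from v∈ with ∈-map⁻ suc v∈
  ... | u , u∈ , refl with complete {suc u} (s≤s z≤n) (∈-upTo⁻ u∈)
  ...   | v∈xs , v<x = ∈-filter⁺ (_<? x) v∈xs v<x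

invcode-ascending : ∀ {xs} → AllPairs _<_ xs → invcode xs ≡ replicate (length xs) 0
invcode-ascending []                    = refl
invcode-ascending {x ∷ xs} (x<xs ∷ asc) =
  cong₂ _∷_ (cong length (filter-none (_<? x) (All.map ℕ.<-asym x<xs))) (invcode-ascending asc)

∈-tail : ∀ {v x : ℕ} {xs} → v ∈ x ∷ xs → v ≢ x → v ∈ xs
∈-tail (here v≡x)   v≢x = contradiction v≡x v≢x
∈-tail (there v∈xs) _   = v∈xs

≤pred⇒< : ∀ {v b} → 1 ≤ b → v ≤ pred b → v < b
≤pred⇒< (s≤s _) v≤b-1 = s≤s v≤b-1

-- For decreasing bs the entries b ≤ m of the head have all of 1, …, b − 1 to
-- their right, and the entries exceeding m have exactly 1, …, m smaller to
-- their right; k records how much of 1, …, m is still present.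
invcode-stdHead : ∀ {m} c k bs tl → k ≤ m →
  AllPairs (λ b b′ → b′ ≤ b × (b ≡ b′ → m < b)) bs →
  All (λ b → 1 ≤ b × b ≤ suc m × pred b ≤ k) bs →
  Unique (stdHead m c bs ++ tl) →
  All (1 ≤_) (stdHead m c bs ++ tl) →
  (∀ {v} → v ∈ stdHead m c bs ++ tl → v ≤ m ⊎ m + c < v) →
  (∀ {v} → 1 ≤ v → v ≤ k → v ∈ stdHead m c bs ++ tl) →
  invcode (stdHead m c bs ++ tl) ≡ map pred bs ++ invcode tl
invcode-stdHead c k [] tl _ _ _ _ _ _ _ = refl
invcode-stdHead {m} c k (b ∷ bs) tl k≤m (b≥ ∷ desc) ((1≤b , b≤1+m , b-1≤k) ∷ ranges) u pos gaps full
  with b ≤? m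
... | yes b≤m rewrite dec-true (b ≤? m) b≤m with u | pos
...   | b∉ ∷ u′ | _ ∷ pos′ = cong₂ _∷_
  (countLess-interval u′
    (λ v∈ v<b → All.lookup pos′ v∈ , ℕ.<⇒≤pred v<b)
    (λ 1≤v v≤b-1 → let v<b = ≤pred⇒< 1≤b v≤b-1 in remaining 1≤v v≤b-1 , v<b))
  -- The value b is now used up, and since the entries decrease, nothing beyond 1, ..., b - 1 is
  -- needed further right.
  (invcode-stdHead c (pred b) bs tl (ℕ.≤-trans b-1≤k k≤m) desc
    (All.zipWith (λ ((1≤b′ , b′≤1+m , _) , b′≤b , _) → 1≤b′ , b′≤1+m , ℕ.pred-mono-≤ b′≤b) (ranges , b≥))
    u′ pos′ (gaps ∘ there) remaining)
  where
  remaining : ∀ {v} → 1 ≤ v → v ≤ pred b → v ∈ stdHead m c bs ++ tl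
  remaining 1≤v v≤b-1 = ∈-tail (full 1≤v (ℕ.≤-trans v≤b-1 b-1≤k)) (ℕ.<⇒≢ (≤pred⇒< 1≤b v≤b-1))
invcode-stdHead {m} c k (b ∷ bs) tl k≤m (b≥ ∷ desc) ((1≤b , b≤1+m , b-1≤k) ∷ ranges) u pos gaps full
  | no b≰m rewrite dec-false (b ≤? m) b≰m | ℕ.≤-antisym b≤1+m (ℕ.≰⇒> b≰m) with u | pos
...   | b∉ ∷ u′ | _ ∷ pos′ = cong₂ _∷_
  (countLess-interval u′
    (λ v∈ v<b → All.lookup pos′ v∈ , small (gaps (there v∈)) v<b)
    (λ 1≤v v≤m → remaining 1≤v (ℕ.≤-trans v≤m b-1≤k) , ℕ.≤-<-trans v≤m (ℕ.m<m+n m z<s)))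
  -- Here b = m + 1, so pred b ≤ k ≤ m forces k = m. The value m + c + 1 just used lies above 1,
  -- ..., m, and k is kept.
  (invcode-stdHead (suc c) k bs tl k≤m desc
    ranges u′ pos′ gaps′ remaining)
  where
  small : ∀ {v} → v ≤ m ⊎ m + c < v → v < m + suc c → v ≤ m
  small (inj₁ v≤m)   _     = v≤m
  small (inj₂ m+c<v) v<m+1+c =
    contradiction (ℕ.≤-trans (ℕ.≤-reflexive (ℕ.+-suc m c)) m+c<v) (ℕ.<⇒≱ v<m+1+c)
  remaining : ∀ {v} → 1 ≤ v → v ≤ k → v ∈ stdHead m (suc c) bs ++ tl
  remaining 1≤v v≤k = ∈-tail (full 1≤v v≤k) (ℕ.<⇒≢ (ℕ.≤-<-trans (ℕ.≤-trans v≤k k≤m) (ℕ.m<m+n m z<s)))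
  gaps′ : ∀ {v} → v ∈ stdHead m (suc c) bs ++ tl → v ≤ m ⊎ m + suc c < v
  gaps′ v∈ with gaps (there v∈)
  ... | inj₁ v≤m   = inj₁ v≤m
  -- The next value m + c + 1 stands at the head, and distinctness excludes it from the rest.
  ... | inj₂ m+c<v = inj₂ (ℕ.≤∧≢⇒< (ℕ.≤-trans (ℕ.≤-reflexive (ℕ.+-suc m c)) m+c<v) (All.lookup b∉ v∈))

stdHead-positive : ∀ {m c bs} → All (1 ≤_) bs → All (1 ≤_) (stdHead m c bs)
stdHead-positive []             = []
stdHead-positive {m} {c} {b ∷ bs} (1≤b ∷ pos) with b ≤ᵇ m
... | true  = 1≤b ∷ stdHead-positive pos
... | false = ℕ.≤-trans (s≤s z≤n) (ℕ.m≤n+m (suc c) m) ∷ stdHead-positive pos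

get-++-zeros : ∀ xs k → xs ++ replicate k 0 ≐ xs
get-++-zeros (x ∷ xs) k       zero    = refl
get-++-zeros (x ∷ xs) k       (suc l) = get-++-zeros xs k l
get-++-zeros []       zero    l       = refl
get-++-zeros []       (suc k) zero    = refl
get-++-zeros []       (suc k) (suc l) = get-++-zeros [] k l

-- The code lowers each entry of r_{m+1,n}(α) by one, and pred (m + 1 - x) = m - x gives r_{m,n}(α).
-- The increasing tail adds only zeros, invisible to `≐`.
rPoly-partition : ∀ {m n a} → length a ≡ n → All (_≤ m) a → NoPositiveRepeat a → isPartition a ≡ true →
  rPoly m n (mono a) ≋ 𝔖 (stdList m n a)
rPoly-partition {m} {n} {a} |a|≡n a≤m a-ok a-partition = begin
  mono (rExp m n a)          ≈⟨ pointwise⇒≋ ((refl , λ l → trans (cong (λ s → get s l) code≡)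
                                  (get-++-zeros (rExp m n a) zeros l)) ∷ []) ⟨
  mono (invcode w)           ≡⟨ 𝔖-dominant w dominant ⟨
  𝔖 w                        ∎
  where
  open SetoidReasoning ≋-setoid
  w  = stdList m n a
  β  = map (suc m ∸_) (reverse a)
  hd = stdHead m 0 β
  tl = missing hd (n + m)
  zeros = length tl

  w≡ : w ≡ hd ++ tl
  w≡ = cong (λ hd → hd ++ missing hd (n + m)) (restrictions≡ m a |a|≡n)

  descending : AllPairs (λ b b′ → b′ ≤ b × (b ≡ b′ → m < b)) β
  descending = AllPairs.zip
    ( AllPairs.map⁺ (AllPairs.map (ℕ.∸-monoʳ-≤ (suc m)) (AllPairs-reverse (isPartition⇒AllPairs a a-partition)))
    , complement-repeats a≤m a-ok)

  ranges : All (λ b → 1 ≤ b × b ≤ suc m × pred b ≤ m) β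
  ranges = All.map⁺ (All-resp-↭ (↭-sym (↭-reverse a)) (All.map
    (λ {x} x≤m → ℕ.m<n⇒0<n∸m (s≤s x≤m) , ℕ.m∸n≤m (suc m) x , ℕ.pred-mono-≤ (ℕ.m∸n≤m (suc m) x)) a≤m))

  rExp≡ : rExp m n a ≡ map (m ∸_) (reverse a)
  rExp≡ = subst (λ n → rExp m n a ≡ map (m ∸_) (reverse a)) |a|≡n (rExp-reverse m a)

  code≡ : invcode w ≡ rExp m n a ++ replicate zeros 0
  code≡ = trans (cong invcode w≡) (trans
    (invcode-stdHead 0 m β tl ℕ.≤-refl descending ranges
      (++-missing-unique (n + m) (stdHead-unique (complement-repeats a≤m a-ok)))
      (All.++⁺ (stdHead-positive (All.map proj₁ ranges)) (missing-positive hd (n + m)))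
      (λ {v} _ → Sum.map₂ (subst (_< v) (sym (ℕ.+-identityʳ m))) (ℕ.≤-<-connex v m))
      (λ 1≤v v≤m → ∈-++-missing hd (n + m) 1≤v (ℕ.≤-trans v≤m (ℕ.m≤n+m m n))))
    (cong₂ _++_ (trans (sym (map-∘ (reverse a)))
        (trans (map-cong (ℕ.pred[m∸n]≡m∸[1+n] (suc m)) (reverse a)) (sym rExp≡)))
      (invcode-ascending (missing-ascending hd (n + m)))))

  dominant : isPartition (invcode w) ≡ true
  dominant = trans (cong isPartition code≡) (AllPairs⇒isPartition (AllPairs.++⁺
    (subst (AllPairs (λ x y → y ≤ x)) (sym rExp≡)
      (AllPairs.map⁺ (AllPairs.map (ℕ.∸-monoʳ-≤ m) (AllPairs-reverse (isPartition⇒AllPairs a a-partition)))))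
    (zeros-descending zeros)
    (All.tabulate λ _ → All.replicate⁺ zeros z≤n)))
    where
    zeros-descending : ∀ k → AllPairs (λ x y → y ≤ x) (replicate k 0)
    zeros-descending zero    = []
    zeros-descending (suc k) = All.replicate⁺ k z≤n ∷ zeros-descending k

-- Induction along the top Lascoux recursion

rPoly-hatLfuel : ∀ {m n} f a → length a ≡ n → noninversions a < f → All (_≤ m) a → NoPositiveRepeat a →
  rPoly m n (hatLfuel f a) ≋ 𝔖 (stdList m n a)
rPoly-hatLfuel {m} {n} (suc f) a |a|≡n a<f a≤m a-ok with isPartition a in partition | firstAscent-view a
... | true  | _ = rPoly-partition |a|≡n a≤m a-ok partition
... | false | inj₂ (_ , ())
... | false | inj₁ (i , e , p) rewrite e = begin
  rPoly m n (π̂ i (hatLfuel f a′))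
    ≈⟨ Mirror.rPoly-π̂ m n i position mirrored (hatLfuel f a′) (hatLfuel-bounded m f a′ (All⇒Bounded a′≤m)) ⟩
  ∂ position (rPoly m n (hatLfuel f a′))
    ≈⟨ ∂-cong position (rPoly-hatLfuel f a′ (trans (↭-length (swapAt-↭ p′)) |a|≡n)
         (ℕ.<-≤-trans (noninversions-swapAt-< p′) (s≤s⁻¹ a<f)) a′≤m
         (AllPairs-swapAt (λ zero-repeat y≡x → trans y≡x (zero-repeat (sym y≡x))) p′ a-ok)) ⟩
  ∂ position (𝔖 (stdList m n a′))
    ≡⟨ cong (∂ position ∘ 𝔖) std-swap ⟩
  ∂ position (𝔖 (swapAt position (stdList m n a)))
    ≈⟨ 𝔖-ascent (stdList m n a) (stdList-unique |a|≡n a≤m a-ok) ascent ⟨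
  𝔖 (stdList m n a) ∎
  where
  open SetoidReasoning ≋-setoid
  p′ = FirstAscent⇒Ascent p
  a′ = swapAt i a
  open StdAscent (stdAscent |a|≡n a≤m p′)
  a′≤m : All (_≤ m) a′
  a′≤m = All-resp-↭ (↭-sym (swapAt-↭ p′)) a≤m
  All⇒Bounded : ∀ {a} → All (_≤ m) a → Bounded m a
  All⇒Bounded []            k       = z≤n
  All⇒Bounded (x≤m ∷ a≤m)   zero    = x≤m
  All⇒Bounded (x≤m ∷ a≤m)   (suc k) = All⇒Bounded a≤m k

All-toList : ∀ {p} {P : ℕ → Set p} {n} (v : Vec ℕ n) → (∀ i → P (lookup v i)) → All P (toList v)
All-toList []      Pv = []
All-toList (x ∷ v) Pv = Pv zero ∷ All-toList v (Pv ∘ suc)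

snowy⇒noPositiveRepeat : ∀ {n} (α : Vec ℕ n) → Snowy α → NoPositiveRepeat (toList α)
snowy⇒noPositiveRepeat []      snowy = []
snowy⇒noPositiveRepeat (x ∷ α) snowy =
  All-toList α (λ j → zero-repeat x λ 0<x → snowy zero (suc j) (λ ()) 0<x)
  ∷ snowy⇒noPositiveRepeat α (λ i j i≢j → snowy (suc i) (suc j) (i≢j ∘ Fin.suc-injective))
  where
  zero-repeat : ∀ x {y} → (0 < x → x ≢ y) → x ≡ y → x ≡ 0
  zero-repeat zero    _       _   = refl
  zero-repeat (suc x) distinct x≡y = contradiction x≡y (distinct z<s)

theorem3p6 : (m n : ℕ) (α : Vec ℕ n) → 1 ≤ m → 1 ≤ n → Snowy α →
    (∀ i → lookup α i ≤ m) →
    rPoly m n (hatL (toList α)) ≈P schubert (std m n α)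
theorem3p6 m (suc n) α@(x ∷ α′) 1≤m 1≤n snowy α≤m = coefficients (begin
  rPoly m (suc n) (hatL (toList α))   ≈⟨ rPoly-hatLfuel _ (toList α) (length-toList α)
                                           (noninversions-bound x (toList α′))
                                           (All-toList α α≤m) (snowy⇒noPositiveRepeat α snowy) ⟩
  -- The value 1 occurs in the one-line notation, which is therefore nonempty.
  𝔖 (stdList m (suc n) (toList α))    ≡⟨ schubert≡𝔖 (∈-++-missing (restrictions m (suc n) (toList α)) (suc n + m)
                                           (s≤s z≤n) (s≤s z≤n)) ⟨
  schubert (std m (suc n) α)          ∎)
  where open SetoidReasoning ≋-setoid
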